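{- There exists a nowhere dense class $\mathscr{C}$ of graphs such that for every positive integer $r$, $$\sup_{G\in\mathscr{C}}\frac{\gamma_r(G)}{\gamma^\star_r(G)}=+\infty.$$
   Context: A class $\mathscr{C}$ is nowhere dense if for every $r$ there is $t(r)$ such that $K_{t(r)}$ is not a depth-$r$ minor of any $G\in\mathscr{C}$, where $H$ on $\{v_1,\dots,v_n\}$ is a depth-$r$ minor of $G$ if there are connected pairwise vertex-disjoint subgraphs $H_1,\dots,H_n$ of $G$ of radius at most $r$ with an edge of $G$ between $H_i$ and $H_j$ whenever $v_iv_j\in E(H)$. $\gamma_r(G)$ is the minimum size of a set $D\subseteq V(G)$ such that every vertex is at distance at most $r$ from $D$. $\gamma^\star_r(G)$ is the minimum of $\sum_{v\in V(G)}x_v$ over $x\geq 0$ with $\sum_{v\in N_r(u)}x_v\geq1$ for all $u\in V(G)$, where $N_r(u)$ is the set of vertices at distance at most $r$ from $u$. -}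

module Defs where

open import Data.Nat using (ℕ; zero; suc; _≤_)
open import Data.Bool using (Bool; true; false; _∧_; _∨_; T)
open import Data.Fin using (Fin; zero; suc)
open import Data.Fin.Properties using () renaming (_≟_ to _≟ᶠ_)
open import Data.Fin.Subset using (Subset; _∈_; ∣_∣)
open import Data.Product using (Σ; ∃; ∃-syntax; _×_)
open import Relation.Binary.PropositionalEquality using (_≡_; _≢_)
open import Relation.Nullary using (¬_)
open import Relation.Nullary.Decidable using (⌊_⌋)
open import Data.Integer using (+_)
open import Data.Rational as ℚ using (ℚ; 0ℚ; 1ℚ)

record Graph : Set where
  field
    n     : ℕ
    adj   : Fin n → Fin n → Bool
    sym   : ∀ u v → adj u v ≡ adj v u
    irrefl : ∀ v → adj v v ≡ false
open Graph public

anyᶠ : ∀ {m} → (Fin m → Bool) → Bool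
anyᶠ {zero}  f = false
anyᶠ {suc m} f = f zero ∨ anyᶠ (λ i → f (suc i))

reachWithin : (G : Graph) → (Fin (n G) → Bool) → ℕ → Fin (n G) → Fin (n G) → Bool
reachWithin G S zero    u v = S u ∧ ⌊ u ≟ᶠ v ⌋
reachWithin G S (suc r) u v =
  reachWithin G S r u v ∨ anyᶠ (λ w → reachWithin G S r u w ∧ (adj G w v ∧ S v))

inBall : (G : Graph) → ℕ → Fin (n G) → Fin (n G) → Bool
inBall G r u v = reachWithin G (λ _ → true) r u v

-- K_t is a depth-r minor of G: branch sets B i (i : Fin t), pairwise
-- disjoint, each inducing a connected subgraph of radius ≤ r (witnessed by a
-- centre c i ∈ B i reaching every vertex of B i within distance r inside B i),
-- with an edge of G between B i and B j for all i ≠ j.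
CliqueDepthMinor : ℕ → ℕ → Graph → Set
CliqueDepthMinor r t G =
  Σ (Fin t → Subset (n G)) λ B →
  Σ (Fin t → Fin (n G)) λ c →
    (∀ i → c i ∈ B i)
  × (∀ i v → v ∈ B i → T (reachWithin G (λ w → Data.Vec.lookup (B i) w) r (c i) v))
  × (∀ i j v → i ≢ j → v ∈ B i → v ∈ B j → Data.Empty.⊥)
  × (∀ i j → i ≢ j → ∃[ u ] ∃[ v ] (u ∈ B i × v ∈ B j × T (adj G u v)))
  where import Data.Vec
        import Data.Empty

Class : Set₁
Class = Graph → Set

NowhereDense : Class → Set
NowhereDense 𝒞 = ∀ r → ∃[ t ] (∀ G → 𝒞 G → ¬ CliqueDepthMinor r t G)

IsRDominating : (G : Graph) → ℕ → Subset (n G) → Set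
IsRDominating G r D = ∀ u → ∃[ v ] (v ∈ D × T (inBall G r u v))

IsDomNumber : (G : Graph) → ℕ → ℕ → Set
IsDomNumber G r k =
  (∃[ D ] (IsRDominating G r D × ∣ D ∣ ≡ k))
  × (∀ D → IsRDominating G r D → k ≤ ∣ D ∣)

sumᶠ : ∀ {m} → (Fin m → ℚ) → ℚ
sumᶠ {zero}  f = 0ℚ
sumᶠ {suc m} f = f zero ℚ.+ sumᶠ (λ i → f (suc i))

IsFracRDominating : (G : Graph) → ℕ → (Fin (n G) → ℚ) → Set
IsFracRDominating G r x =
  (∀ v → 0ℚ ℚ.≤ x v)
  × (∀ u → 1ℚ ℚ.≤ sumᶠ (λ v → if inBall G r u v then x v else 0ℚ))
  where open import Data.Bool using (if_then_else_)

IsFracDomNumber : (G : Graph) → ℕ → ℚ → Set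
IsFracDomNumber G r q =
  (∃[ x ] (IsFracRDominating G r x × sumᶠ x ≡ q))
  × (∀ x → IsFracRDominating G r x → q ℚ.≤ sumᶠ x)

ℕ→ℚ : ℕ → ℚ
ℕ→ℚ k = + k ℚ./ 1

{-# OPTIONS --safe #-}
-- Take a d-uniform hypergraph on n = s·d points in which every set of n/2 points contains an edge,
-- and which is built edge by edge so that the points of each new edge are pairwise far apart in the
-- older part. Give every edge a new vertex adjacent to its points, with a pendant path of r vertices
-- starting there, and add a hub adjacent to all points, itself the end of a path of length r. The far
-- end of an edge's path has only that path and the points of the edge within distance r, and the hub
-- is within distance r of all vertices but these far ends. Hence an r-dominating set yields a
-- transversal of the hypergraph, so it has more than n/2 elements, whereas weight 1/d on each point
-- and 1 on the hub is a fractional r-domination of total s + 1. This is optimal because the hypergraph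
-- contains a perfect matching, so that s + 1 balls of radius r are pairwise disjoint.
--
-- A K₄ minor of small depth contains a K₃ minor avoiding the hub, hence a short closed walk through
-- three disjoint sets. Its last-built vertex would have two neighbours joined by a short walk through
-- older vertices, which the construction forbids. With the separation growing along the class, any
-- given depth therefore has only finitely many graphs with a K₄ minor of that depth.
--
-- The hypergraph is found greedily: by iterated averaging some admissible edge lies in a fraction of
-- at least 4⁻ᵈ of the large sets not yet containing an edge, so 4ᵈ·n steps exhaust all of them, while
-- the degrees remain bounded independently of n.
module Submission where

open import Defs hiding (sym)
open import Data.Nat as ℕ using (ℕ; zero; suc; _≤_; z≤n; s≤s)
import Data.Nat.Properties as ℕ
open import Data.Bool using (Bool; true; false; if_then_else_; T)
open import Data.Bool.Properties using (T-∧; T-∨)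
open import Data.Empty using (⊥; ⊥-elim)
open import Data.Fin as Fin using (Fin; zero; suc; toℕ; fromℕ; inject≤; punchIn; combine; quotient; remQuot; opposite; splitAt; _↑ˡ_; _↑ʳ_)
import Data.Fin.Properties as Fin
open import Data.Fin.Subset using (Subset; inside; outside; ⊤; ∣_∣) renaming (_∈_ to _∈ˢ_)
open import Data.Fin.Subset.Properties using (∈⊤; anySubset?) renaming (_∈?_ to _∈ˢ?_)
open import Data.Integer as ℤ using ()
import Data.Integer.Properties as ℤ
open import Data.List using (List; []; _∷_; _++_; length; map; filter; concatMap; allFin; lookup; drop)
open import Data.List.Properties using (length-++; length-map; length-filter; length-tabulate)
open import Data.List.Membership.Propositional using (_∈_; _∉_)
import Data.List.Membership.DecPropositional as DecMembership
open import Data.List.Membership.Propositional.Properties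
  using (∈-filter⁺; ∈-filter⁻; ∈-++⁺ˡ; ∈-++⁺ʳ; ∈-concatMap⁺; ∈-map⁺; ∈-map⁻; ∈-allFin; ∈-lookup)
open import Data.List.Relation.Binary.Subset.Propositional using () renaming (_⊆_ to _⊆ˡ_)
open import Data.List.Relation.Unary.All as All using (All; []; _∷_)
import Data.List.Relation.Unary.All.Properties as All
open import Data.List.Relation.Unary.AllPairs using ([]; _∷_)
open import Data.List.Relation.Unary.Any as Any using (here; there; index)
open import Data.List.Relation.Unary.Any.Properties using (lookup-index)
open import Data.List.Relation.Unary.Unique.Propositional using (Unique)
import Data.List.Relation.Unary.Unique.Propositional.Properties as Unique
open import Data.Nat.Coprimality as Coprime using (1-coprimeTo)
open import Data.Product using (Σ; ∃; ∃-syntax; _×_; _,_; proj₁; proj₂)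
open import Data.Rational as ℚ using (ℚ; 0ℚ; 1ℚ; mkℚ)
import Data.Rational.Properties as ℚ
open import Data.Sum using (_⊎_; inj₁; inj₂; [_,_]′; swap)
open import Data.Unit using (tt)
open import Data.Vec as Vec using (Vec; []; _∷_; head; toList)
open import Data.Vec.Properties using (length-toList; lookup⇒[]=; lookup∘tabulate; []=⇒lookup)
open import Data.Vec.Membership.Propositional using () renaming (_∈_ to _∈ᵛ_)
import Data.Vec.Membership.DecPropositional as DecMembershipᵛ
open import Data.Vec.Membership.Propositional.Properties using (∈-toList⁺; ∈-tabulate⁺) renaming (∈-lookup to ∈ᵛ-lookup)
import Data.Vec.Relation.Unary.All as Allᵛ
open Allᵛ using () renaming (All to Allᵛ; [] to []ᵛ; _∷_ to _∷ᵛ_)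
import Data.Vec.Relation.Unary.AllPairs as AllPairsᵛ
open import Data.Vec.Relation.Unary.AllPairs.Core using () renaming (AllPairs to AllPairsᵛ; [] to []ᵖ; _∷_ to _∷ᵖ_)
import Data.Vec.Relation.Unary.Any as Anyᵛ
import Data.Vec.Relation.Unary.Any.Properties as Anyᵛ
import Data.Vec.Relation.Unary.Unique.Propositional as Uniqueᵛ
import Data.Vec.Relation.Unary.Unique.Propositional.Properties as Uniqueᵛ
open import Function using (_∘_; _$_; id; const; Equivalence)
open import Level using (0ℓ)
open import Relation.Binary.Core using (Rel)
open import Relation.Binary.Definitions using (Symmetric; tri<; tri≈; tri>)
open import Relation.Binary.PropositionalEquality
open import Relation.Nullary using (¬_; Dec; yes; no; does; contradiction; ¬?)
open import Relation.Nullary.Decidable using (T?; ⌊_⌋; toWitness; fromWitness; _×-dec_; _⊎-dec_; dec-true; dec-false)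
open import Relation.Unary using (Pred; Decidable; U; _∩_)

-- Walks with a bound on their length

module Walks where

  open import Data.Nat using (_+_; _<_)
  open import Data.Nat.Properties

  -- The index l is an upper bound for the length.
  data Walk {V : Set} (_~_ : Rel V 0ℓ) (P : Pred V 0ℓ) : ℕ → V → V → Set where
    stop : ∀ {l x} → P x → Walk _~_ P l x x
    go   : ∀ {l x y z} → P x → x ~ y → Walk _~_ P l y z → Walk _~_ P (suc l) x z

  module _ {V : Set} {_~_ : Rel V 0ℓ} {P : Pred V 0ℓ} where

    source : ∀ {l x y} → Walk _~_ P l x y → P x
    source (stop p)   = p
    source (go p _ _) = p

    target : ∀ {l x y} → Walk _~_ P l x y → P y
    target (stop p)   = p
    target (go _ _ w) = target w

    lengthen : ∀ {l l′ x y} → l ≤ l′ → Walk _~_ P l x y → Walk _~_ P l′ x y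
    lengthen _         (stop p)   = stop p
    lengthen (s≤s l≤l′) (go p e w) = go p e (lengthen l≤l′ w)

    infixr 5 _++ʷ_
    _++ʷ_ : ∀ {l l′ x y z} → Walk _~_ P l x y → Walk _~_ P l′ y z → Walk _~_ P (l + l′) x z
    _++ʷ_ {l} {l′} (stop p) w′ = lengthen (m≤n+m l′ l) w′
    go p e w ++ʷ w′ = go p e (w ++ʷ w′)

    snoc : ∀ {l x y z} → Walk _~_ P l x y → y ~ z → P z → Walk _~_ P (suc l) x z
    snoc (stop p)   e q = go p e (stop q)
    snoc (go p d w) e q = go p d (snoc w e q)

    reverseʷ : Symmetric _~_ → ∀ {l x y} → Walk _~_ P l x y → Walk _~_ P l y x
    reverseʷ _  (stop p)   = stop p
    reverseʷ ~-sym (go p e w) = snoc (reverseʷ ~-sym w) (~-sym e) p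

  mapʷ : ∀ {V V′ : Set} {_~_ : Rel V 0ℓ} {_~′_ : Rel V′ 0ℓ} {P : Pred V 0ℓ} {P′ : Pred V′ 0ℓ}
         (h : V → V′) → (∀ {x y} → x ~ y → h x ~′ h y) → (∀ {x} → P x → P′ (h x)) →
         ∀ {l x y} → Walk _~_ P l x y → Walk _~′_ P′ l (h x) (h y)
  mapʷ h h~ hP (stop p)   = stop (hP p)
  mapʷ h h~ hP (go p e w) = go (hP p) (h~ e) (mapʷ h h~ hP w)

  Disjoint : ∀ {V : Set} → Pred V 0ℓ → Pred V 0ℓ → Set
  Disjoint A B = ∀ {x} → A x → B x → ⊥

  -- A closed walk cut into three pieces of length at most l that live in A, B and C.
  record Triangle {V : Set} (_~_ : Rel V 0ℓ) (l : ℕ) (P A B C : Pred V 0ℓ) : Set where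
    field
      {a a′ b b′ c c′} : V
      walkA : Walk _~_ (P ∩ A) l a a′
      walkB : Walk _~_ (P ∩ B) l b b′
      walkC : Walk _~_ (P ∩ C) l c c′
      a′~b : a′ ~ b
      b′~c : b′ ~ c
      c′~a : c′ ~ a

  -- Excluding short triangles by peeling off the youngest vertex

  module Peeling {V : Set} {_~_ : Rel V 0ℓ} (~-sym : Symmetric _~_)
                 (rank : V → ℕ) (rank-injective : ∀ {x y} → rank x ≡ rank y → x ≡ y)
                 (U : Pred V 0ℓ) where

    Below : ℕ → Pred V 0ℓ
    Below k x = U x × rank x < k

    -- The walk lives in `Below (rank v)`, so f and f′ themselves are older than v: the condition
    -- concerns only neighbours already present when v is added.
    Scattered : ℕ → Set
    Scattered L = ∀ {v f f′} → U v → f ≢ f′ → v ~ f → v ~ f′ → ¬ Walk _~_ (Below (rank v)) L f f′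

    -- The first visit and the last visit of a walk to the vertex v of rank k.
    record Through (k l : ℕ) (A : Pred V 0ℓ) (x y : V) : Set where
      field
        v      : V
        Uv     : U v
        Av     : A v
        rank-v : rank v ≡ k
        {i j}  : ℕ
        i+j≤l  : i + j ≤ l
        enter  : x ≡ v ⊎ ∃ λ f → v ~ f × Walk _~_ (Below k ∩ A) i x f
        leave  : y ≡ v ⊎ ∃ λ f → v ~ f × Walk _~_ (Below k ∩ A) j f y

    -- By injectivity of `rank` at most one vertex has rank k, so a walk that leaves `Below k` does
    -- so only there. Everything between its first and last visit is dropped; the two remaining
    -- pieces together are no longer than the walk, whence `i+j≤l`.
    split : ∀ {k l A x y} → Walk _~_ (Below (suc k) ∩ A) l x y →
            Walk _~_ (Below k ∩ A) l x y ⊎ Through k l A x y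
    split {k} {l} {x = x} (stop ((u , r) , a)) with rank x ≟ k
    ... | no  r≢k = inj₁ (stop ((u , ≤∧≢⇒< (≤-pred r) r≢k) , a))
    ... | yes r≡k = inj₂ record
      { Uv = u ; Av = a ; rank-v = r≡k ; i = 0 ; j = 0 ; i+j≤l = z≤n ; enter = inj₁ refl ; leave = inj₁ refl }
    split {k} {suc l} {A} {x} (go ((u , r) , a) e w) with rank x ≟ k | split w
    ... | no  r≢k | inj₁ w′ = inj₁ (go ((u , ≤∧≢⇒< (≤-pred r) r≢k) , a) e w′)
    ... | yes r≡k | inj₁ w′ = inj₂ record
      { Uv = u ; Av = a ; rank-v = r≡k ; i = 0 ; i+j≤l = n≤1+n l ; enter = inj₁ refl ; leave = inj₂ (_ , e , w′) }
    ... | yes r≡k | inj₂ t = inj₂ record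
      { Uv = u ; Av = a ; rank-v = r≡k ; i = 0 ; j = Through.j t
      ; i+j≤l = ≤-trans (m≤n+m _ (Through.i t)) (m≤n⇒m≤1+n (Through.i+j≤l t))
      ; enter = inj₁ refl
      ; leave = subst (λ v → _ ≡ v ⊎ ∃ λ f → v ~ f × Walk _~_ (Below k ∩ A) (Through.j t) f _)
                      (rank-injective (trans (Through.rank-v t) (sym r≡k))) (Through.leave t) }
    ... | no  r≢k | inj₂ t = inj₂ record
      { Uv = Uv ; Av = Av ; rank-v = rank-v ; i = suc i ; i+j≤l = s≤s i+j≤l ; enter = enter′ enter ; leave = leave }
      where
      open Through t
      below : (Below k ∩ A) x
      below = (u , ≤∧≢⇒< (≤-pred r) r≢k) , a
      enter′ : (_ ≡ v ⊎ ∃ λ f → v ~ f × Walk _~_ (Below k ∩ A) i _ f) → x ≡ v ⊎ ∃ λ f → v ~ f × Walk _~_ (Below k ∩ A) (suc i) x f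
      enter′ (inj₁ refl)          = inj₂ (x , ~-sym e , stop below)
      enter′ (inj₂ (f , v~f , p)) = inj₂ (f , v~f , go below e p)

    -- The way round that avoids v consists of two parts of the piece in A, of length at most l
    -- each, the other two pieces with the edge between them, and the two edges back to A: at most
    -- 4l + 3 in all.
    module _ {L l : ℕ} (scattered : Scattered L) (4l+3≤L : l + suc ((l + suc l) + suc l) ≤ L) where

      private
        weaken : ∀ {k m} {A : Pred V 0ℓ} {x y} → Walk _~_ (Below k ∩ A) m x y → Walk _~_ (Below k) m x y
        weaken = mapʷ (λ x → x) (λ e → e) proj₁

        join : ∀ {k} {A B : Pred V 0ℓ} {x x′ y y′} → Walk _~_ (Below k ∩ A) l x x′ → x′ ~ y →
               Walk _~_ (Below k ∩ B) l y y′ → Walk _~_ (Below k) (l + suc l) x y′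
        join w e w′ = weaken w ++ʷ go (proj₁ (target w)) e (weaken w′)

      -- Going round the rest of the closed walk joins the two neighbours of v on it through older
      -- vertices, so by `Scattered` these neighbours coincide and v can be bypassed. Where the
      -- piece begins or ends at v, a neighbour lies in B or C; disjointness then makes the two
      -- neighbours distinct, which is absurd.
      shortcut : ∀ {k A B C a a′ b c} → Disjoint A B → Disjoint B C → Disjoint C A →
                 Through k l A a a′ → B b → C c → a′ ~ b → c ~ a →
                 Walk _~_ (Below k) (l + suc l) b c → Walk _~_ (Below k ∩ A) l a a′
      shortcut {k} {A} {a = a} {a′} {b} {c} dAB dBC dCA t Bb Cc a′~b c~a bc = cases enter leave
        where
        open Through t
        far : ∀ {m f f′} → m ≤ L → f ≢ f′ → v ~ f → v ~ f′ → ¬ Walk _~_ (Below k) m f f′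
        far m≤L f≢f′ e e′ w = scattered Uv f≢f′ e e′
          (subst (λ k → Walk _~_ (Below k) L _ _) (sym rank-v) (lengthen m≤L w))
        i≤l : i ≤ l
        i≤l = ≤-trans (m≤m+n i j) i+j≤l
        j≤l : j ≤ l
        j≤l = ≤-trans (m≤n+m j i) i+j≤l
        l+sl≤ : suc (l + suc l) ≤ suc ((l + suc l) + suc l)
        l+sl≤ = s≤s (m≤m+n _ (suc l))
        cases : (a ≡ v ⊎ ∃ λ f → v ~ f × Walk _~_ (Below k ∩ A) i a f) →
                (a′ ≡ v ⊎ ∃ λ f → v ~ f × Walk _~_ (Below k ∩ A) j f a′) → Walk _~_ (Below k ∩ A) l a a′
        cases (inj₁ refl) (inj₁ refl) = ⊥-elim (far
          (≤-trans (≤-trans (n≤1+n _) l+sl≤) (≤-trans (m≤n+m _ l) 4l+3≤L))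
          (λ { refl → dBC Bb Cc }) a′~b (~-sym c~a) bc)
        cases (inj₁ refl) (inj₂ (f , v~f , w)) = ⊥-elim (far
          (≤-trans (+-mono-≤ j≤l l+sl≤) 4l+3≤L)
          (λ { refl → dCA Cc (proj₂ (source w)) }) v~f (~-sym c~a)
          (weaken w ++ʷ go (proj₁ (target w)) a′~b bc))
        cases (inj₂ (f , v~f , w)) (inj₁ refl) = ⊥-elim (far
          (≤-trans (+-mono-≤ i≤l l+sl≤) 4l+3≤L)
          (λ { refl → dAB (proj₂ (target w)) Bb }) v~f a′~b
          (reverseʷ ~-sym (weaken w) ++ʷ go (proj₁ (source w)) (~-sym c~a) (reverseʷ ~-sym bc)))
        cases (inj₂ (f , v~f , w)) (inj₂ (f′ , v~f′ , w′)) with rank f ≟ rank f′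
        ... | yes r≡r′ = lengthen i+j≤l (w ++ʷ subst (λ f → Walk _~_ _ j f a′) (sym (rank-injective r≡r′)) w′)
        ... | no  r≢r′ = ⊥-elim (far bound (λ f≡f′ → r≢r′ (sym (cong rank f≡f′))) v~f′ v~f
          (weaken w′ ++ʷ go (proj₁ (target w′)) a′~b (bc ++ʷ go (target bc) c~a (weaken w))))
          where
          bound : j + suc ((l + suc l) + suc i) ≤ L
          bound = ≤-trans (+-mono-≤ j≤l (s≤s (+-monoʳ-≤ (l + suc l) (s≤s i≤l)))) 4l+3≤L

      -- Induction on the rank bound. By disjointness the vertex of rank k lies on at most one of
      -- the three pieces, so at most one has to be rerouted by `shortcut`, while the other two
      -- provide the way round.
      noTriangle : ∀ k {A B C} → Disjoint A B → Disjoint B C → Disjoint C A → ¬ Triangle _~_ l (Below k) A B C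
      noTriangle zero _ _ _ t with source (Triangle.walkA t)
      ... | (_ , ()) , _
      noTriangle (suc k) {A} {B} {C} dAB dBC dCA t = cases (split walkA) (split walkB) (split walkC)
        where
        open Triangle t
        meet : ∀ {A B : Pred V 0ℓ} {x x′ y y′} → Disjoint A B → Through k l A x x′ → ¬ Through k l B y y′
        meet {B = B} d s t = d (Through.Av s) (subst B (rank-injective (trans (Through.rank-v t) (sym (Through.rank-v s)))) (Through.Av t))
        cases : Walk _~_ (Below k ∩ A) l a a′ ⊎ Through k l A a a′ → Walk _~_ (Below k ∩ B) l b b′ ⊎ Through k l B b b′ →
                Walk _~_ (Below k ∩ C) l c c′ ⊎ Through k l C c c′ → ⊥
        cases (inj₁ wA) (inj₁ wB) (inj₁ wC) = noTriangle k dAB dBC dCA record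
          { walkA = wA ; walkB = wB ; walkC = wC ; a′~b = a′~b ; b′~c = b′~c ; c′~a = c′~a }
        cases (inj₂ tA) (inj₁ wB) (inj₁ wC) = noTriangle k dAB dBC dCA record
          { walkA = shortcut dAB dBC dCA tA (proj₂ (source wB)) (proj₂ (target wC)) a′~b c′~a (join wB b′~c wC)
          ; walkB = wB ; walkC = wC ; a′~b = a′~b ; b′~c = b′~c ; c′~a = c′~a }
        cases (inj₁ wA) (inj₂ tB) (inj₁ wC) = noTriangle k dAB dBC dCA record
          { walkB = shortcut dBC dCA dAB tB (proj₂ (source wC)) (proj₂ (target wA)) b′~c a′~b (join wC c′~a wA)
          ; walkA = wA ; walkC = wC ; a′~b = a′~b ; b′~c = b′~c ; c′~a = c′~a }
        cases (inj₁ wA) (inj₁ wB) (inj₂ tC) = noTriangle k dAB dBC dCA record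
          { walkC = shortcut dCA dAB dBC tC (proj₂ (source wA)) (proj₂ (target wB)) c′~a b′~c (join wA a′~b wB)
          ; walkA = wA ; walkB = wB ; a′~b = a′~b ; b′~c = b′~c ; c′~a = c′~a }
        cases (inj₂ s) (inj₂ t) _ = meet dAB s t
        cases (inj₂ s) (inj₁ _) (inj₂ t) = meet dCA t s
        cases (inj₁ _) (inj₂ s) (inj₂ t) = meet dBC s t

open Walks

-- Sparse hypergraphs without small transversals, preceded by counting in lists

module Hypergraphs where

  open import Data.Nat using (_+_; _*_; _^_; _<_; _≤?_; pred; >-nonZero)
  open import Data.Nat.ListAction using (sum)
  open import Data.Nat.Properties
  open import Algebra.Properties.CommutativeSemigroup +-commutativeSemigroup using (x∙yz≈y∙xz)
  open import Algebra.Properties.CommutativeSemigroup *-commutativeSemigroup using () renaming (x∙yz≈y∙xz to x∙yz≈y∙xz*)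

  module _ {n : ℕ} where
    open DecMembership (Fin._≟_ {n}) public using () renaming (_∈?_ to _∈ˡ?_; _∉?_ to _∉ˡ?_)
    open DecMembershipᵛ (Fin._≟_ {n}) public using () renaming (_∈?_ to _∈ᵛ?_)

  private variable
    X Y : Set

  lookup-injective : ∀ {xs : List X} → Unique xs → ∀ i j → lookup xs i ≡ lookup xs j → i ≡ j
  lookup-injective (_ ∷ _)  zero    zero    _ = refl
  lookup-injective (x∉ ∷ _) zero    (suc j) e = ⊥-elim (All.lookup x∉ (∈-lookup j) e)
  lookup-injective (x∉ ∷ _) (suc i) zero    e = ⊥-elim (All.lookup x∉ (∈-lookup i) (sym e))
  lookup-injective (_ ∷ u)  (suc i) (suc j) e = cong suc (lookup-injective u i j e)

  unique⇒length≤ : ∀ {xs ys : List X} → Unique xs → xs ⊆ˡ ys → length xs ≤ length ys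
  unique⇒length≤ {xs = xs} {ys} u sub = Fin.injective⇒≤ {f = f} f-injective
    where
    f : Fin (length xs) → Fin (length ys)
    f i = index (sub (∈-lookup {xs = xs} i))
    f-injective : ∀ {i j} → f i ≡ f j → i ≡ j
    f-injective {i} {j} e = lookup-injective u i j
      (trans (lookup-index (sub (∈-lookup {xs = xs} i)))
             (trans (cong (lookup ys) e) (sym (lookup-index (sub (∈-lookup {xs = xs} j))))))

  length-avoiding : ∀ {n} {xs : List (Fin n)} (bad : List (Fin n)) → Unique xs →
                    length xs ≤ length (filter (_∉ˡ? bad) xs) + length bad
  length-avoiding {xs = xs} bad u = subst (length xs ≤_) (length-++ (filter (_∉ˡ? bad) xs)) (unique⇒length≤ u sub)
    where
    sub : xs ⊆ˡ filter (_∉ˡ? bad) xs ++ bad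
    sub {x} x∈ with x ∈ˡ? bad
    ... | yes x∈bad = ∈-++⁺ʳ _ x∈bad
    ... | no  x∉bad = ∈-++⁺ˡ (∈-filter⁺ (_∉ˡ? bad) x∈ x∉bad)

  length-filter-∘ : ∀ {P Q R : Pred X 0ℓ} (P? : Decidable P) (Q? : Decidable Q) (R? : Decidable R) →
                    (∀ {x} → P x → Q x → R x) → ∀ xs →
                    length (filter Q? (filter P? xs)) ≤ length (filter R? xs)
  length-filter-∘ P? Q? R? h [] = z≤n
  length-filter-∘ P? Q? R? h (x ∷ xs) with ih ← length-filter-∘ P? Q? R? h xs | P? x
  ... | no _ = ≤-trans ih (length-filter-step)
    where
    length-filter-step : length (filter R? xs) ≤ length (filter R? (x ∷ xs))
    length-filter-step with R? x
    ... | yes _ = n≤1+n _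
    ... | no _  = ≤-refl
  ... | yes p with Q? x | R? x
  ...   | yes q | yes _ = s≤s ih
  ...   | yes q | no ¬r = contradiction (h p q) ¬r
  ...   | no _  | yes _ = m≤n⇒m≤1+n ih
  ...   | no _  | no _  = ih

  length-filter-¬ : ∀ {P : Pred X 0ℓ} (P? : Decidable P) xs →
                    length xs ≡ length (filter P? xs) + length (filter (¬? ∘ P?) xs)
  length-filter-¬ P? [] = refl
  length-filter-¬ P? (x ∷ xs) with ih ← length-filter-¬ P? xs | P? x
  ... | yes _ = cong suc ih
  ... | no  _ = trans (cong suc ih) (sym (+-suc _ _))

  sum-map-≥ : ∀ (f : X → ℕ) c xs → (∀ {x} → x ∈ xs → c ≤ f x) → length xs * c ≤ sum (map f xs)
  sum-map-≥ f c [] _ = z≤n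
  sum-map-≥ f c (x ∷ xs) h = +-mono-≤ (h (here refl)) (sum-map-≥ f c xs (h ∘ there))

  sum-map-≤ : ∀ (f : X → ℕ) c xs → (∀ {x} → x ∈ xs → f x ≤ c) → sum (map f xs) ≤ length xs * c
  sum-map-≤ f c [] _ = z≤n
  sum-map-≤ f c (x ∷ xs) h = +-mono-≤ (h (here refl)) (sum-map-≤ f c xs (h ∘ there))

  sum-map-* : ∀ (f : X → ℕ) c xs → sum (map (λ x → c * f x) xs) ≡ c * sum (map f xs)
  sum-map-* f c [] = sym (*-zeroʳ c)
  sum-map-* f c (x ∷ xs) = trans (cong (c * f x +_) (sum-map-* f c xs)) (sym (*-distribˡ-+ c (f x) _))

  ∃-≥average : ∀ (f : X → ℕ) c xs → 0 < length xs → length xs * c ≤ sum (map f xs) → ∃ λ x → x ∈ xs × c ≤ f x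
  ∃-≥average f c (x ∷ xs) _ h with c ≤? f x
  ... | yes c≤ = x , here refl , c≤
  ∃-≥average f c (x ∷ []) _ h | no c≰ = contradiction (subst₂ _≤_ (+-identityʳ c) (+-identityʳ (f x)) h) c≰
  ∃-≥average f c (x ∷ xs@(_ ∷ _)) _ h | no c≰ =
    let y , y∈ , c≤ = ∃-≥average f c xs (s≤s z≤n)
          (+-cancelˡ-≤ c _ _ (≤-trans h (+-monoˡ-≤ _ (<⇒≤ (≰⇒> c≰)))))
    in y , there y∈ , c≤

  module _ {R : X → Y → Set} (R? : ∀ x y → Dec (R x y)) where

    double-count : ∀ xs ys → sum (map (λ x → length (filter (R? x) ys)) xs)
                           ≡ sum (map (λ y → length (filter (λ x → R? x y) xs)) ys)
    double-count [] ys = sym (n≤0⇒n≡0 (≤-trans (sum-map-≤ _ 0 ys (λ _ → z≤n)) (≤-reflexive (*-zeroʳ (length ys)))))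
    double-count (x ∷ xs) ys = trans (cong (length (filter (R? x) ys) +_) (double-count xs ys)) (sym (column ys))
      where
      column : ∀ ys → sum (map (λ y → length (filter (λ x → R? x y) (x ∷ xs))) ys)
                    ≡ length (filter (R? x) ys) + sum (map (λ y → length (filter (λ x → R? x y) xs)) ys)
      column [] = refl
      column (y ∷ ys) with ih ← column ys | R? x y
      ... | yes _ = cong suc (trans (cong (m y +_) ih) (x∙yz≈y∙xz (m y) (length (filter (R? x) ys)) (sum (map m ys))))
        where m = λ y → length (filter (λ x → R? x y) xs)
      ... | no  _ = trans (cong (m y +_) ih) (x∙yz≈y∙xz (m y) (length (filter (R? x) ys)) (sum (map m ys)))
        where m = λ y → length (filter (λ x → R? x y) xs)

  -- Nearness, degrees and balls in a hypergraph

  Edge : ℕ → ℕ → Set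
  Edge n d = Vec (Fin n) d

  Hop : ∀ {n d} → List (Edge n d) → Fin n → Fin n → Set
  Hop es p q = ∃ λ e → e ∈ es × p ∈ᵛ e × q ∈ᵛ e

  Near : ∀ {n d} → List (Edge n d) → ℕ → Fin n → Fin n → Set
  Near es = Walk (Hop es) U

  -- Edges are listed newest first.
  data Sparse {n d} (L : ℕ) : List (Edge n d) → Set where
    []  : Sparse L []
    _∷_ : ∀ {e es} → AllPairsᵛ (λ p q → ¬ Near es L p q) e → Sparse L es → Sparse L (e ∷ es)

  degree : ∀ {n d} → List (Edge n d) → Fin n → ℕ
  degree es p = length (filter (p ∈ᵛ?_) es)

  module _ {n d : ℕ} (es : List (Edge n d)) where

    neighbours : Fin n → List (Fin n)
    neighbours p = concatMap toList (filter (p ∈ᵛ?_) es)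

    ball : ℕ → Fin n → List (Fin n)
    ball zero    p = p ∷ []
    ball (suc l) p = p ∷ concatMap (ball l) (neighbours p)

    ∈-ball : ∀ {l p q} → Near es l p q → q ∈ ball l p
    ∈-ball {zero}  (stop _) = here refl
    ∈-ball {suc l} (stop _) = here refl
    ∈-ball {suc l} {p} (go _ (e , e∈ , p∈ , x∈) w) = there (∈-concatMap⁺ (ball l) (Any.map (λ { refl → ∈-ball w })
      (∈-concatMap⁺ toList (Any.map (λ { refl → ∈-toList⁺ x∈ }) (∈-filter⁺ (p ∈ᵛ?_) e∈ p∈)))))

  length-concatMap≤ : ∀ (f : X → List Y) c xs → (∀ x → length (f x) ≤ c) → length (concatMap f xs) ≤ length xs * c
  length-concatMap≤ f c [] _ = z≤n
  length-concatMap≤ f c (x ∷ xs) h = subst (_≤ _) (sym (length-++ (f x))) (+-mono-≤ (h x) (length-concatMap≤ f c xs h))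

  -- The recursion for balls of radius l when every point has at most w neighbours, counted with
  -- multiplicity.
  ballBound : ℕ → ℕ → ℕ
  ballBound w zero    = 1
  ballBound w (suc l) = 1 + w * ballBound w l

  length-ball≤ : ∀ {n d} (es : List (Edge n d)) Δ → (∀ p → degree es p ≤ Δ) →
                 ∀ l p → length (ball es l p) ≤ ballBound (Δ * d) l
  length-ball≤ es Δ h zero p = s≤s z≤n
  length-ball≤ {d = d} es Δ h (suc l) p = s≤s (≤-trans (length-concatMap≤ (ball es l) _ (neighbours es p) (length-ball≤ es Δ h l))
    (*-monoˡ-≤ _ (≤-trans (length-concatMap≤ toList d (filter (p ∈ᵛ?_) es) (λ e → ≤-reflexive (length-toList e))) (*-monoˡ-≤ d (h p)))))

  saturated : ∀ {n d} → List (Edge n d) → ℕ → List (Fin n)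
  saturated {n} es Δ = filter (λ p → Δ ≤? degree es p) (allFin n)

  -- Incidences between saturated points and edges are counted in two ways: at least `Δ` at each
  -- point, at most d in each edge. New edges will avoid these points, which keeps all degrees at
  -- most `Δ`.
  length-saturated : ∀ {n d} (es : List (Edge n d)) Δ → length (saturated es Δ) * Δ ≤ length es * d
  length-saturated {n} {d} es Δ = begin
    length sat * Δ                                                    ≤⟨ sum-map-≥ (degree es) Δ sat (proj₂ ∘ ∈-filter⁻ sat? {xs = allFin n}) ⟩
    sum (map (degree es) sat)                                         ≡⟨ double-count (λ p e → p ∈ᵛ? e) sat es ⟩
    sum (map (λ e → length (filter (_∈ᵛ? e) sat)) es)                 ≤⟨ sum-map-≤ _ d es (λ {e} _ → inEdge e) ⟩
    length es * d                                                     ∎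
    where
    open ≤-Reasoning
    sat = saturated es Δ
    sat? = λ p → Δ ≤? degree es p
    inEdge : ∀ e → length (filter (_∈ᵛ? e) sat) ≤ d
    inEdge e = subst (length (filter (_∈ᵛ? e) sat) ≤_) (length-toList e) (unique⇒length≤ (Unique.filter⁺ (_∈ᵛ? e) (Unique.filter⁺ sat? (Unique.allFin⁺ n)))
      (∈-toList⁺ ∘ proj₂ ∘ ∈-filter⁻ (_∈ᵛ? e) {xs = sat}))

  -- Choosing an edge by iterated averaging

  elements : ∀ {n} → Subset n → List (Fin n)
  elements {n} S = filter (_∈ˢ? S) (allFin n)

  Big : ∀ {n} → Subset n → Set
  Big {n} S = n ≤ 2 * length (elements S)

  -- A big set has at least n/2 points, and at most n/4 points are bad, so at least n/4 of its
  -- points are admissible. Averaging over the admissible points gives one that lies in a quarter of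
  -- the sets in F.
  pick : ∀ {n} (bad : List (Fin n)) (F : List (Subset n)) → 0 < n → 4 * length bad ≤ n → All Big F →
         ∃ λ p → p ∉ bad × length F ≤ 4 * length (filter (p ∈ˢ?_) F)
  pick {n} bad F 0<n 4bad≤n big =
    let p , p∈ , h = ∃-≥average (λ p → 4 * length (filter (p ∈ˢ?_) F)) (length F) ps 0<ps average
    in p , proj₂ (∈-filter⁻ (_∉ˡ? bad) {xs = allFin n} p∈) , h
    where
    open ≤-Reasoning
    ps = filter (_∉ˡ? bad) (allFin n)
    n≤ps+bad : n ≤ length ps + length bad
    n≤ps+bad = subst (_≤ length ps + length bad) (length-tabulate {n = n} id) (length-avoiding bad (Unique.allFin⁺ n))
    0<ps : 0 < length ps
    0<ps with length ps | n≤ps+bad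
    ... | zero  | n≤bad = contradiction (≤-trans (*-monoʳ-≤ 4 n≤bad) 4bad≤n)
                                        (<⇒≱ (m<m+n n (≤-trans 0<n (m≤m+n n _))))
    ... | suc _ | _ = s≤s z≤n
    ps≤n : length ps ≤ n
    ps≤n = ≤-trans (length-filter (_∉ˡ? bad) (allFin n)) (≤-reflexive (length-tabulate id))
    split : ∀ {S} → Big S → n ≤ 4 * length (filter (_∈ˢ? S) ps)
    split {S} b = +-cancelʳ-≤ n n _ (begin
      n + n                                           ≡⟨ cong (n +_) (sym (+-identityʳ n)) ⟩
      2 * n                                           ≤⟨ *-monoʳ-≤ 2 b ⟩
      2 * (2 * length (elements S))                   ≡⟨ *-assoc 2 2 (length (elements S)) ⟨
      4 * length (elements S)                         ≤⟨ *-monoʳ-≤ 4 (≤-trans (length-avoiding bad (Unique.filter⁺ (_∈ˢ? S) (Unique.allFin⁺ n))) (+-monoˡ-≤ _ reorder)) ⟩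
      4 * (length (filter (_∈ˢ? S) ps) + length bad)  ≡⟨ *-distribˡ-+ 4 (length (filter (_∈ˢ? S) ps)) _ ⟩
      4 * length (filter (_∈ˢ? S) ps) + 4 * length bad ≤⟨ +-monoʳ-≤ _ 4bad≤n ⟩
      4 * length (filter (_∈ˢ? S) ps) + n             ∎)
      where
      reorder : length (filter (_∉ˡ? bad) (elements S)) ≤ length (filter (_∈ˢ? S) ps)
      reorder = unique⇒length≤ (Unique.filter⁺ (_∉ˡ? bad) (Unique.filter⁺ (_∈ˢ? S) (Unique.allFin⁺ n)))
        (λ x∈ → let x∈S , x∉bad = ∈-filter⁻ (_∉ˡ? bad) {xs = elements S} x∈
                    x∈n , xS = ∈-filter⁻ (_∈ˢ? S) {xs = allFin n} x∈S
                in ∈-filter⁺ (_∈ˢ? S) (∈-filter⁺ (_∉ˡ? bad) x∈n x∉bad) xS)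
    average : length ps * length F ≤ sum (map (λ p → 4 * length (filter (p ∈ˢ?_) F)) ps)
    average = begin
      length ps * length F                                    ≤⟨ *-monoˡ-≤ _ ps≤n ⟩
      n * length F                                            ≡⟨ *-comm n _ ⟩
      length F * n                                            ≤⟨ sum-map-≥ _ n F (split ∘ All.lookup big) ⟩
      sum (map (λ S → 4 * length (filter (_∈ˢ? S) ps)) F)     ≡⟨ sum-map-* (λ S → length (filter (_∈ˢ? S) ps)) 4 F ⟩
      4 * sum (map (λ S → length (filter (_∈ˢ? S) ps)) F)     ≡⟨ cong (4 *_) (double-count _∈ˢ?_ ps F) ⟨
      4 * sum (map (λ p → length (filter (p ∈ˢ?_) F)) ps)     ≡⟨ sum-map-* (λ p → length (filter (p ∈ˢ?_) F)) 4 ps ⟨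
      sum (map (λ p → 4 * length (filter (p ∈ˢ?_) F)) ps)     ∎

  _⊆?_ : ∀ {n k} (ps : Vec (Fin n) k) (S : Subset n) → Dec (Allᵛ (_∈ˢ S) ps)
  ps ⊆? S = Allᵛ.all? (_∈ˢ? S) ps

  -- `pick` applied k times, each time to the sets that contain all points chosen so far, at the
  -- cost of a factor 4. After each choice the list `near p` joins the forbidden points; the term
  -- `k * b` reserves room for that.
  choose : ∀ {n} (near : Fin n → List (Fin n)) {b} → (∀ p → length (near p) ≤ b) → 0 < n →
           ∀ k (bad : List (Fin n)) (F : List (Subset n)) → 4 * (length bad + k * b) ≤ n → All Big F →
           ∃ λ (ps : Vec (Fin n) k) → Allᵛ (_∉ bad) ps × AllPairsᵛ (λ p q → q ∉ near p) ps
             × length F ≤ 4 ^ k * length (filter (ps ⊆?_) F)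
  choose near _ _ zero bad F _ _ = [] , []ᵛ , []ᵖ , ≤-reflexive (trans (sym (cong length (filter-[] F))) (sym (+-identityʳ _)))
    where
    filter-[] : ∀ F → filter ([] ⊆?_) F ≡ F
    filter-[] []      = refl
    filter-[] (S ∷ F) = cong (S ∷_) (filter-[] F)
  choose {n} near {b} near≤b 0<n (suc k) bad F room big =
    let p , p∉bad , F≤4F₁ = pick bad F 0<n (≤-trans (*-monoʳ-≤ 4 (m≤m+n (length bad) _)) room) big
        F₁ = filter (p ∈ˢ?_) F
        room₁ = ≤-trans (*-monoʳ-≤ 4 (begin
          length (near p ++ bad) + k * b          ≡⟨ cong (_+ k * b) (length-++ (near p)) ⟩
          length (near p) + length bad + k * b    ≤⟨ +-monoˡ-≤ _ (+-monoˡ-≤ _ (near≤b p)) ⟩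
          b + length bad + k * b                  ≡⟨ +-assoc b _ _ ⟩
          b + (length bad + k * b)                ≡⟨ x∙yz≈y∙xz b (length bad) _ ⟩
          length bad + suc k * b                  ∎)) room
        ps , ps∉ , ps-far , F₁≤ = choose near near≤b 0<n k (near p ++ bad) F₁ room₁ (All.filter⁺ (p ∈ˢ?_) big)
    in p ∷ ps
     , (p∉bad ∷ᵛ Allᵛ.map (λ q∉ q∈ → q∉ (∈-++⁺ʳ (near p) q∈)) ps∉)
     , (Allᵛ.map (λ q∉ q∈ → q∉ (∈-++⁺ˡ q∈)) ps∉ ∷ᵖ ps-far)
     , (begin
       length F                                              ≤⟨ F≤4F₁ ⟩
       4 * length F₁                                         ≤⟨ *-monoʳ-≤ 4 F₁≤ ⟩
       4 * (4 ^ k * length (filter (ps ⊆?_) F₁))             ≡⟨ *-assoc 4 (4 ^ k) (length (filter (ps ⊆?_) F₁)) ⟨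
       4 ^ suc k * length (filter (ps ⊆?_) F₁)               ≤⟨ *-monoʳ-≤ (4 ^ suc k) (length-filter-∘ (p ∈ˢ?_) (ps ⊆?_) ((p ∷ ps) ⊆?_) _∷ᵛ_ F) ⟩
       4 ^ suc k * length (filter ((p ∷ ps) ⊆?_) F)          ∎)
    where open ≤-Reasoning

  -- Enumeration of subsets and the numerical estimate

  subsets : ∀ n → List (Subset n)
  subsets zero    = [] ∷ []
  subsets (suc n) = map (inside ∷_) (subsets n) ++ map (outside ∷_) (subsets n)

  ∈-subsets : ∀ {n} (S : Subset n) → S ∈ subsets n
  ∈-subsets []            = here refl
  ∈-subsets (true  ∷ S)   = ∈-++⁺ˡ (∈-map⁺ (inside ∷_) (∈-subsets S))
  ∈-subsets (false ∷ S)   = ∈-++⁺ʳ _ (∈-map⁺ (outside ∷_) (∈-subsets S))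

  length-subsets : ∀ n → length (subsets n) ≡ 2 ^ n
  length-subsets zero    = refl
  length-subsets (suc n) = trans (length-++ (map (inside ∷_) (subsets n)))
    (cong₂ _+_ (trans (length-map _ (subsets n)) (length-subsets n))
               (trans (trans (length-map _ (subsets n)) (length-subsets n)) (sym (+-identityʳ _))))

  ^-distribʳ-* : ∀ n a b → (a * b) ^ n ≡ a ^ n * b ^ n
  ^-distribʳ-* zero    a b = refl
  ^-distribʳ-* (suc n) a b = trans (cong (a * b *_) (^-distribʳ-* n a b)) ([m*n]*[o*p]≡[m*o]*[n*p] a b (a ^ n) (b ^ n))

  -- Bernoulli's inequality (1 + 1/m)ᵏ ≥ 1 + k/m, cleared of denominators.
  bernoulli : ∀ m k → m ^ k * (m + k) ≤ suc m ^ k * m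
  bernoulli m zero    = ≤-reflexive (cong (1 *_) (+-identityʳ m))
  bernoulli m (suc k) = begin
    m * m ^ k * (m + suc k)       ≡⟨ cong (_* (m + suc k)) (*-comm m (m ^ k)) ⟩
    m ^ k * m * (m + suc k)       ≡⟨ *-assoc (m ^ k) m (m + suc k) ⟩
    m ^ k * (m * (m + suc k))     ≤⟨ *-monoʳ-≤ (m ^ k) step ⟩
    m ^ k * (suc m * (m + k))     ≡⟨ x∙yz≈y∙xz* (m ^ k) (suc m) (m + k) ⟩
    suc m * (m ^ k * (m + k))     ≤⟨ *-monoʳ-≤ (suc m) (bernoulli m k) ⟩
    suc m * (suc m ^ k * m)       ≡⟨ *-assoc (suc m) (suc m ^ k) m ⟨
    suc m ^ suc k * m             ∎
    where
    open ≤-Reasoning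
    step : m * (m + suc k) ≤ suc m * (m + k)
    step = begin
      m * (m + suc k)      ≡⟨ cong (m *_) (+-suc m k) ⟩
      m * suc (m + k)      ≡⟨ *-suc m (m + k) ⟩
      m + m * (m + k)      ≤⟨ +-monoˡ-≤ _ (m≤m+n m k) ⟩
      suc m * (m + k)      ∎

  -- For positive m, Bernoulli with exponent m + 1 gives (1 + 1/m)^(m+1) ≥ 2 + 1/m. With q = m + 1
  -- this says (1 - 1/q)^q < 1/2, so q further edges more than halve the bound on the missed sets.
  2m^[1+m]<[1+m]^[1+m] : ∀ m → 2 * m ^ suc m < suc m ^ suc m
  2m^[1+m]<[1+m]^[1+m] zero      = s≤s z≤n
  2m^[1+m]<[1+m]^[1+m] m@(suc _) = *-cancelʳ-< m _ _ (begin-strict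
    2 * m ^ suc m * m            ≡⟨ cong (_* m) (*-comm 2 (m ^ suc m)) ⟩
    m ^ suc m * 2 * m            ≡⟨ *-assoc (m ^ suc m) 2 m ⟩
    m ^ suc m * (2 * m)          <⟨ *-monoʳ-< (m ^ suc m) {{m^n≢0 m (suc m)}} (+-monoʳ-< m (s≤s (≤-reflexive (+-identityʳ m)))) ⟩
    m ^ suc m * (m + suc m)      ≤⟨ bernoulli m (suc m) ⟩
    suc m ^ suc m * m            ∎)
    where open ≤-Reasoning

  -- The greedy construction

  Covers : ∀ {n d} → List (Edge n d) → Subset n → Set
  Covers es S = ∃ λ e → e ∈ es × Allᵛ (_∈ˢ S) e

  module Greedy {n d : ℕ} (L Δ q′ : ℕ) (4^d≡q : 4 ^ d ≡ suc q′) (0<Δ : 0 < Δ) (0<n : 0 < n)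
                (base : List (Edge n d)) (base-sparse : Sparse L base) (base-degree : ∀ p → degree base p ≤ Δ)
                (few-saturated : 8 * ((length base + suc q′ * n) * d) ≤ Δ * n)
                (small-balls : 8 * (d * ballBound (Δ * d) L) ≤ n) where

    -- The state after t added edges. `missed` contains every big set without an edge so far, and
    -- `shrinking` bounds its length by 2ⁿ(1 - 1/q)ᵗ for q = `suc q′`, cleared of denominators.
    record Stage (t : ℕ) : Set where
      field
        edges       : List (Edge n d)
        extends     : base ⊆ˡ edges
        sparse      : Sparse L edges
        degree≤Δ    : ∀ p → degree edges p ≤ Δ
        length≤     : length edges ≤ length base + t
        missed      : List (Subset n)
        missed-big  : All Big missed
        accounted   : ∀ S → Big S → Covers edges S ⊎ S ∈ missed
        shrinking   : length missed * suc q′ ^ t ≤ 2 ^ n * q′ ^ t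

    start : Stage 0
    start = record
      { edges = base ; extends = id ; sparse = base-sparse ; degree≤Δ = base-degree ; length≤ = m≤m+n _ 0
      ; missed = filter (λ S → n ≤? 2 * length (elements S)) (subsets n)
      ; missed-big = All.all-filter _ (subsets n)
      ; accounted = λ S big → inj₂ (∈-filter⁺ _ (∈-subsets S) big)
      ; shrinking = *-monoˡ-≤ 1 (≤-trans (length-filter _ (subsets n)) (≤-reflexive (length-subsets n)))
      }

    module _ {t : ℕ} (stage : Stage t) where
      open Stage stage
      open ≤-Reasoning

      -- Two eighths of the points: `few-saturated` controls the saturated ones as long as at most
      -- `suc q′ * n` edges have been added, `small-balls` the d balls. Together they make the
      -- quarter that `pick` may forbid.
      room : t < suc q′ * n → 4 * (length (saturated edges Δ) + d * ballBound (Δ * d) L) ≤ n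
      room t<T = *-cancelˡ-≤ 2 (begin
        2 * (4 * (length sat + d * b))            ≡⟨ *-assoc 2 4 (length sat + d * b) ⟨
        8 * (length sat + d * b)                  ≡⟨ *-distribˡ-+ 8 (length sat) (d * b) ⟩
        8 * length sat + 8 * (d * b)              ≤⟨ +-mono-≤ 8sat≤n (≤-trans small-balls (≤-reflexive (sym (+-identityʳ n)))) ⟩
        2 * n                                     ∎)
        where
        b = ballBound (Δ * d) L
        sat = saturated edges Δ
        8sat≤n : 8 * length sat ≤ n
        8sat≤n = *-cancelʳ-≤ (8 * length sat) n Δ {{>-nonZero 0<Δ}} (begin
          8 * length sat * Δ                        ≡⟨ *-assoc 8 (length sat) Δ ⟩
          8 * (length sat * Δ)                      ≤⟨ *-monoʳ-≤ 8 (length-saturated edges Δ) ⟩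
          8 * (length edges * d)                    ≤⟨ *-monoʳ-≤ 8 (*-monoˡ-≤ d (≤-trans length≤ (+-monoʳ-≤ (length base) (<⇒≤ t<T)))) ⟩
          8 * ((length base + suc q′ * n) * d)      ≤⟨ few-saturated ⟩
          Δ * n                                     ≡⟨ *-comm Δ n ⟩
          n * Δ                                     ∎)

      module _ (e : Edge n d) (e∉sat : Allᵛ (_∉ saturated edges Δ) e)
               (e-far : AllPairsᵛ (λ p q → q ∉ ball edges L p) e)
               (missed≤ : length missed ≤ suc q′ * length (filter (e ⊆?_) missed)) where

        missed′ = filter (¬? ∘ (e ⊆?_)) missed
        -- At least one in `suc q′` of the missed sets contains e, so at most the fraction q′/(q′ +
        -- 1) survives.
        decrease : length missed′ * suc q′ ≤ q′ * length missed
        decrease = +-cancelˡ-≤ (length missed) _ _ (begin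
          length missed + length missed′ * suc q′       ≤⟨ +-mono-≤ missed≤ (≤-reflexive (*-comm (length missed′) (suc q′))) ⟩
          suc q′ * length (filter (e ⊆?_) missed) + suc q′ * length missed′
            ≡⟨ *-distribˡ-+ (suc q′) (length (filter (e ⊆?_) missed)) (length missed′) ⟨
          suc q′ * (length (filter (e ⊆?_) missed) + length missed′)
            ≡⟨ cong (suc q′ *_) (length-filter-¬ (e ⊆?_) missed) ⟨
          suc q′ * length missed                        ∎)
        far : ∀ {k} (ps : Vec (Fin n) k) → AllPairsᵛ (λ p q → q ∉ ball edges L p) ps → AllPairsᵛ (λ p q → ¬ Near edges L p q) ps
        far [] []ᵖ = []ᵖ
        far (_ ∷ ps) (h ∷ᵖ hs) = Allᵛ.map (λ q∉ near → q∉ (∈-ball edges near)) h ∷ᵖ far ps hs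
        degree′ : ∀ p → degree (e ∷ edges) p ≤ Δ
        degree′ p with p ∈ᵛ? e
        -- Points of e are unsaturated, so their degree was below `Δ` before e was added.
        ... | yes p∈e = ≰⇒> (λ Δ≤ → Allᵛ.lookup e∉sat p∈e (∈-filter⁺ (λ p → Δ ≤? degree edges p) (∈-allFin p) Δ≤))
        ... | no  _   = degree≤Δ p
        accounted′ : ∀ S → Big S → Covers (e ∷ edges) S ⊎ S ∈ missed′
        accounted′ S big with accounted S big | e ⊆? S
        ... | _ | yes e⊆S = inj₁ (e , here refl , e⊆S)
        ... | inj₁ (e′ , e′∈ , e′⊆S) | no _ = inj₁ (e′ , there e′∈ , e′⊆S)
        ... | inj₂ S∈ | no e⊈S = inj₂ (∈-filter⁺ _ S∈ e⊈S)

        addEdge : Stage (suc t)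
        addEdge = record
          { edges = e ∷ edges
          ; extends = there ∘ extends
          ; sparse = far e e-far ∷ sparse
          ; degree≤Δ = degree′
          ; length≤ = subst (suc (length edges) ≤_) (sym (+-suc _ t)) (s≤s length≤)
          ; missed = filter (¬? ∘ (e ⊆?_)) missed
          ; missed-big = All.filter⁺ (¬? ∘ (e ⊆?_)) missed-big
          ; accounted = accounted′
          ; shrinking = begin
              length missed′ * (suc q′ * suc q′ ^ t)     ≡⟨ *-assoc (length missed′) (suc q′) _ ⟨
              length missed′ * suc q′ * suc q′ ^ t       ≤⟨ *-monoˡ-≤ (suc q′ ^ t) decrease ⟩
              q′ * length missed * suc q′ ^ t            ≡⟨ *-assoc q′ (length missed) _ ⟩
              q′ * (length missed * suc q′ ^ t)          ≤⟨ *-monoʳ-≤ q′ shrinking ⟩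
              q′ * (2 ^ n * q′ ^ t)                      ≡⟨ x∙yz≈y∙xz* q′ (2 ^ n) _ ⟩
              2 ^ n * q′ ^ suc t                         ∎
          }

    extend : ∀ {t} → t < suc q′ * n → Stage t → Stage (suc t)
    extend t<T stage =
      let open Stage stage
          e , e∉sat , e-far , missed≤ = choose (ball edges L) (length-ball≤ edges Δ degree≤Δ L) 0<n d
                                               (saturated edges Δ) missed (room stage t<T) missed-big
      in addEdge stage e e∉sat e-far (subst (λ q → length missed ≤ q * length (filter (e ⊆?_) missed)) 4^d≡q missed≤)

    stage : ∀ t → t ≤ suc q′ * n → Stage t
    stage zero    _  = start
    stage (suc t) t< = extend t< (stage t (<⇒≤ t<))

    abstract
      final : Stage (suc q′ * n)
      final = stage (suc q′ * n) ≤-refl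

    open Stage final public using (edges; extends; sparse)

    -- After qn edges, with q = `suc q′`, the list has length at most 2ⁿ((1 - 1/q)^q)ⁿ. As (1 -
    -- 1/q)^q < 1/2, this is less than 1.
    none-missed : length (Stage.missed final) ≡ 0
    none-missed with length (Stage.missed final) | Stage.shrinking final
    ... | zero  | _ = refl
    ... | suc m | h = contradiction (≤-trans (m≤m+n _ _) h) (<⇒≱ (begin-strict
        2 ^ n * q′ ^ (suc q′ * n)       ≡⟨ cong (2 ^ n *_) (sym (^-*-assoc q′ (suc q′) n)) ⟩
        2 ^ n * (q′ ^ suc q′) ^ n       ≡⟨ ^-distribʳ-* n 2 (q′ ^ suc q′) ⟨
        (2 * q′ ^ suc q′) ^ n           <⟨ ^-monoˡ-< n {{>-nonZero 0<n}} (2m^[1+m]<[1+m]^[1+m] q′) ⟩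
        (suc q′ ^ suc q′) ^ n           ≡⟨ ^-*-assoc (suc q′) (suc q′) n ⟩
        suc q′ ^ (suc q′ * n)           ∎))
      where open ≤-Reasoning

    covers-big : ∀ S → Big S → Covers edges S
    covers-big S big with Stage.missed final | none-missed | Stage.accounted final S big
    ... | _  | _ | inj₁ c = c
    ... | [] | _ | inj₂ ()

  -- The initial edges: a perfect matching into rows of consecutive points

  row : ∀ s d → Fin s → Edge (s * d) d
  row s d k = Vec.tabulate (combine k)

  rows : ∀ s d → List (Edge (s * d) d)
  rows s d = map (row s d) (allFin s)

  ∈-row⁻ : ∀ {s d p} (k : Fin s) → p ∈ᵛ row s d k → ∃ λ a → p ≡ combine k a
  ∈-row⁻ k p∈ = Anyᵛ.tabulate⁻ p∈

  row-disjoint : ∀ {s d p} {k k′ : Fin s} → p ∈ᵛ row s d k → p ∈ᵛ row s d k′ → k ≡ k′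
  row-disjoint {k = k} {k′} p∈ p∈′ =
    let a , e = ∈-row⁻ k p∈ ; a′ , e′ = ∈-row⁻ k′ p∈′
    in Fin.combine-injectiveˡ k a k′ a′ (trans (sym e) e′)

  row-injective : ∀ {s d} {k k′ : Fin s} → row s (suc d) k ≡ row s (suc d) k′ → k ≡ k′
  row-injective {d = d} {k} e = row-disjoint {d = suc d} first (subst (combine k zero ∈ᵛ_) e first)
    where first = ∈-tabulate⁺ (combine {n = suc d} k) zero

  -- Rows are disjoint, so a point of the newest row lies in none of the older ones and is near
  -- itself alone, whatever the value of `L`.
  rows-sparse : ∀ {s d L} {ks : List (Fin s)} → Unique ks → Sparse L (map (row s d) ks)
  rows-sparse [] = []
  rows-sparse {s} {d} {L} {k ∷ ks} (k∉ ∷ u) =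
    far (Uniqueᵛ.tabulate⁺ (λ {a} {b} → Fin.combine-injectiveʳ k a k b)) (λ p∈ p≢q near → p≢q (isolated p∈ near)) ∷ rows-sparse u
    where
    isolated : ∀ {l p q} → p ∈ᵛ row s d k → Near (map (row s d) ks) l p q → p ≡ q
    isolated p∈ (stop _) = refl
    isolated p∈ (go _ (_ , e∈ , p∈′ , _) _) with ∈-map⁻ (row s d) e∈
    ... | k′ , k′∈ , refl = ⊥-elim (All.lookup k∉ k′∈ (row-disjoint p∈ p∈′))
    far : ∀ {m} {R : Fin (s * d) → Fin (s * d) → Set} {e : Edge (s * d) m} → Uniqueᵛ.Unique e →
          (∀ {p q} → p ∈ᵛ e → p ≢ q → R p q) → AllPairsᵛ R e
    far []ᵖ       h = []ᵖ
    far (p≢ ∷ᵖ u) h = Allᵛ.map (h (Anyᵛ.here refl)) p≢ ∷ᵖ far u (h ∘ Anyᵛ.there)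

  rows-degree : ∀ {s d} (p : Fin (s * suc d)) → degree (rows s (suc d)) p ≤ 1
  rows-degree {s} {d} p = unique⇒length≤
    (Unique.filter⁺ (p ∈ᵛ?_) (Unique.map⁺ row-injective (Unique.allFin⁺ s))) only
    where
    only : filter (p ∈ᵛ?_) (rows s (suc d)) ⊆ˡ row s (suc d) (quotient (suc d) p) ∷ []
    only e∈ with ∈-filter⁻ (p ∈ᵛ?_) {xs = rows s (suc d)} e∈
    ... | e∈′ , p∈ with ∈-map⁻ (row s (suc d)) e∈′
    ...   | k , _ , refl with ∈-row⁻ k p∈
    ...     | a , refl = here (cong (row s (suc d)) (sym (cong proj₁ (Fin.remQuot-combine k a))))

  -- The hypergraph and the choice of its constants

  record Hypergraph (L d : ℕ) : Set where
    field
      s      : ℕ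
      0<s    : 0 < s
      edges  : List (Edge (s * d) d)
      sparse : Sparse L edges
      row∈   : ∀ k → row s d k ∈ edges
      evade  : ∀ X → 2 * length X ≤ s * d → ∃ λ e → e ∈ edges × Allᵛ (_∉ X) e

  0<ballBound : ∀ w l → 0 < ballBound w l
  0<ballBound w zero    = s≤s z≤n
  0<ballBound w (suc l) = s≤s z≤n

  -- The constants are fixed in an order that avoids circularity: `Δ` depends on d alone, the ball
  -- bound b on `Δ`, d and `L`, and only then is the number s of rows chosen.
  hypergraph : ∀ L d → Hypergraph L (suc d)
  hypergraph L d′ = record
    { s = s ; 0<s = 0<s ; edges = G.edges ; sparse = G.sparse
    ; row∈ = λ k → G.extends (∈-map⁺ (row s d) (∈-allFin k)) ; evade = evade }
    where
    open ≤-Reasoning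
    d q q′ Δ b s P : ℕ
    d = suc d′
    q = 4 ^ d
    q′ = pred q
    -- At most P rows and q · P greedy edges make (q + 1) · P edges, with d incidences each; this
    -- choice leaves at most an eighth of the points saturated.
    Δ = 8 * (suc q * d)
    b = ballBound (Δ * d) L
    -- Makes P = 8 · b · d, so that d balls fill at most an eighth of the points.
    s = 8 * b
    P = s * d
    q≡ : q ≡ suc q′
    q≡ = sym (suc-pred q {{m^n≢0 4 d}})
    0<s : 0 < s
    0<s = ≤-trans (0<ballBound (Δ * d) L) (m≤m+n b _)
    s≤P : s ≤ P
    s≤P = m≤m*n s d
    few : 8 * ((length (rows s d) + suc q′ * P) * d) ≤ Δ * P
    few = begin
      8 * ((length (rows s d) + suc q′ * P) * d)
        ≡⟨ cong (λ l → 8 * ((l + suc q′ * P) * d)) (trans (length-map (row s d) (allFin s)) (length-tabulate {n = s} id)) ⟩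
      8 * ((s + suc q′ * P) * d)     ≤⟨ *-monoʳ-≤ 8 (*-monoˡ-≤ d (+-monoˡ-≤ _ s≤P)) ⟩
      8 * (suc (suc q′) * P * d)     ≡⟨ cong (λ q → 8 * (suc q * P * d)) (sym q≡) ⟩
      8 * (suc q * P * d)            ≡⟨ cong (8 *_) (trans (*-assoc (suc q) P d) (trans (cong (suc q *_) (*-comm P d)) (sym (*-assoc (suc q) d P)))) ⟩
      8 * (suc q * d * P)            ≡⟨ *-assoc 8 (suc q * d) P ⟨
      Δ * P                          ∎
    small : 8 * (d * b) ≤ P
    small = ≤-reflexive (trans (cong (8 *_) (*-comm d b)) (sym (*-assoc 8 b d)))
    0<Δ : 0 < Δ
    0<Δ = s≤s z≤n
    module G = Greedy {P} {d} L Δ q′ q≡ 0<Δ (≤-trans 0<s s≤P) (rows s d)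
                      (rows-sparse (Unique.allFin⁺ s)) (λ p → ≤-trans (rows-degree {s} {d′} p) 0<Δ) few small
    -- At least half of the points lie outside X, so the complement S of X is big and contains an
    -- edge.
    evade : ∀ X → 2 * length X ≤ P → ∃ λ e → e ∈ G.edges × Allᵛ (_∉ X) e
    evade X 2X≤P =
      let e , e∈ , e⊆S = G.covers-big S big in e , e∈ , Allᵛ.map ∉X e⊆S
      where
      S : Subset P
      S = Vec.tabulate (λ p → does (p ∉ˡ? X))
      ∉X : ∀ {p} → p ∈ˢ S → p ∉ X
      ∉X {p} p∈ p∈X with trans (sym ([]=⇒lookup p∈)) (trans (lookup∘tabulate (λ p → does (p ∉ˡ? X)) p) (dec-false (p ∉ˡ? X) (_$ p∈X)))
      ... | ()
      ∉X⇒∈S : ∀ {p} → p ∉ X → p ∈ˢ S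
      ∉X⇒∈S {p} p∉ = lookup⇒[]= p S (trans (lookup∘tabulate (λ p → does (p ∉ˡ? X)) p) (dec-true (p ∉ˡ? X) p∉))
      P≤ : P ≤ length (elements S) + length X
      P≤ = begin
        P                                                    ≡⟨ length-tabulate id ⟨
        length (allFin P)                                    ≤⟨ length-avoiding X (Unique.allFin⁺ P) ⟩
        length (filter (_∉ˡ? X) (allFin P)) + length X       ≤⟨ +-monoˡ-≤ (length X) (unique⇒length≤ (Unique.filter⁺ (_∉ˡ? X) (Unique.allFin⁺ P))
          (λ p∈ → let p∈P , p∉ = ∈-filter⁻ (_∉ˡ? X) {xs = allFin P} p∈ in ∈-filter⁺ (_∈ˢ? S) p∈P (∉X⇒∈S p∉))) ⟩
        length (elements S) + length X                       ∎
      big : Big S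
      big = +-cancelʳ-≤ P P _ (begin
        P + P                                      ≡⟨ cong (P +_) (sym (+-identityʳ P)) ⟩
        2 * P                                      ≤⟨ *-monoʳ-≤ 2 P≤ ⟩
        2 * (length (elements S) + length X)       ≡⟨ *-distribˡ-+ 2 (length (elements S)) (length X) ⟩
        2 * length (elements S) + 2 * length X     ≤⟨ +-monoʳ-≤ _ 2X≤P ⟩
        2 * length (elements S) + P                ∎)

open Hypergraphs

-- Finite sums of rationals

module RationalSums where

  open import Algebra.Properties.CommutativeMonoid.Sum ℚ.+-0-commutativeMonoid using (sum; ∑-comm; sum-cong-≗)

  -- The fraction k/1 is already in lowest terms; in this form addition computes.
  ℕ→ℚ≡mkℚ : ∀ k → ℕ→ℚ k ≡ mkℚ (ℤ.+ k) 0 (Coprime.sym (1-coprimeTo k))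
  ℕ→ℚ≡mkℚ k = ℚ.normalize-coprime (Coprime.sym (1-coprimeTo k))

  ℕ→ℚ-suc : ∀ k → ℕ→ℚ (suc k) ≡ 1ℚ ℚ.+ ℕ→ℚ k
  ℕ→ℚ-suc k = sym (trans (cong (1ℚ ℚ.+_) (ℕ→ℚ≡mkℚ k)) (cong (λ i → (ℤ.+ 1 ℤ.+ i) ℚ./ 1) (ℤ.*-identityʳ (ℤ.+ k))))

  ℕ→ℚ-+ : ∀ a b → ℕ→ℚ (a ℕ.+ b) ≡ ℕ→ℚ a ℚ.+ ℕ→ℚ b
  ℕ→ℚ-+ zero    b = sym (ℚ.+-identityˡ (ℕ→ℚ b))
  ℕ→ℚ-+ (suc a) b = begin
    ℕ→ℚ (suc (a ℕ.+ b))             ≡⟨ ℕ→ℚ-suc (a ℕ.+ b) ⟩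
    1ℚ ℚ.+ ℕ→ℚ (a ℕ.+ b)            ≡⟨ cong (1ℚ ℚ.+_) (ℕ→ℚ-+ a b) ⟩
    1ℚ ℚ.+ (ℕ→ℚ a ℚ.+ ℕ→ℚ b)        ≡⟨ ℚ.+-assoc 1ℚ (ℕ→ℚ a) (ℕ→ℚ b) ⟨
    1ℚ ℚ.+ ℕ→ℚ a ℚ.+ ℕ→ℚ b          ≡⟨ cong (ℚ._+ ℕ→ℚ b) (ℕ→ℚ-suc a) ⟨
    ℕ→ℚ (suc a) ℚ.+ ℕ→ℚ b           ∎
    where open ≡-Reasoning

  ℕ→ℚ-suc-* : ∀ k x → ℕ→ℚ (suc k) ℚ.* x ≡ x ℚ.+ ℕ→ℚ k ℚ.* x
  ℕ→ℚ-suc-* k x = trans (cong (ℚ._* x) (ℕ→ℚ-suc k))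
    (trans (ℚ.*-distribʳ-+ x 1ℚ (ℕ→ℚ k)) (cong (ℚ._+ ℕ→ℚ k ℚ.* x) (ℚ.*-identityˡ x)))

  ℕ→ℚ-* : ∀ a b → ℕ→ℚ (a ℕ.* b) ≡ ℕ→ℚ a ℚ.* ℕ→ℚ b
  ℕ→ℚ-* zero    b = sym (ℚ.*-zeroˡ (ℕ→ℚ b))
  ℕ→ℚ-* (suc a) b = trans (ℕ→ℚ-+ b (a ℕ.* b))
    (trans (cong (ℕ→ℚ b ℚ.+_) (ℕ→ℚ-* a b)) (sym (ℕ→ℚ-suc-* a (ℕ→ℚ b))))

  0<1 : 0ℚ ℚ.< 1ℚ
  0<1 = ℚ.positive⁻¹ 1ℚ

  0≤1 : 0ℚ ℚ.≤ 1ℚ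
  0≤1 = ℚ.<⇒≤ 0<1

  0≤ℕ→ℚ : ∀ k → 0ℚ ℚ.≤ ℕ→ℚ k
  0≤ℕ→ℚ zero    = ℚ.≤-refl
  0≤ℕ→ℚ (suc k) = subst (0ℚ ℚ.≤_) (sym (ℕ→ℚ-suc k)) (ℚ.+-mono-≤ 0≤1 (0≤ℕ→ℚ k))

  ℕ→ℚ-mono-< : ∀ {a b} → a ℕ.< b → ℕ→ℚ a ℚ.< ℕ→ℚ b
  ℕ→ℚ-mono-< {zero}  {suc b} _ = subst (0ℚ ℚ.<_) (sym (ℕ→ℚ-suc b)) (ℚ.+-mono-<-≤ 0<1 (0≤ℕ→ℚ b))
  ℕ→ℚ-mono-< {suc a} {suc b} (s≤s a<b) = subst₂ ℚ._<_ (sym (ℕ→ℚ-suc a)) (sym (ℕ→ℚ-suc b)) (ℚ.+-monoʳ-< 1ℚ (ℕ→ℚ-mono-< a<b))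

  sumᶠ≡sum : ∀ {n} (f : Fin n → ℚ) → sumᶠ f ≡ sum f
  sumᶠ≡sum {zero}  f = refl
  sumᶠ≡sum {suc n} f = cong (f zero ℚ.+_) (sumᶠ≡sum (f ∘ suc))

  sumᶠ-cong : ∀ {n} {f g : Fin n → ℚ} → f ≗ g → sumᶠ f ≡ sumᶠ g
  sumᶠ-cong {f = f} {g} h = trans (sumᶠ≡sum f) (trans (sum-cong-≗ h) (sym (sumᶠ≡sum g)))

  sumᶠ-comm : ∀ {m n} (f : Fin m → Fin n → ℚ) → sumᶠ (λ i → sumᶠ (f i)) ≡ sumᶠ (λ j → sumᶠ (λ i → f i j))
  sumᶠ-comm f = begin
    sumᶠ (λ i → sumᶠ (f i))              ≡⟨ sumᶠ-cong (sumᶠ≡sum ∘ f) ⟩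
    sumᶠ (λ i → sum (f i))               ≡⟨ sumᶠ≡sum (λ i → sum (f i)) ⟩
    sum (λ i → sum (f i))                ≡⟨ ∑-comm f ⟩
    sum (λ j → sum (λ i → f i j))        ≡⟨ sumᶠ≡sum (λ j → sum (λ i → f i j)) ⟨
    sumᶠ (λ j → sum (λ i → f i j))       ≡⟨ sumᶠ-cong (λ j → sumᶠ≡sum (λ i → f i j)) ⟨
    sumᶠ (λ j → sumᶠ (λ i → f i j))      ∎
    where open ≡-Reasoning

  sumᶠ-mono : ∀ {n} {f g : Fin n → ℚ} → (∀ i → f i ℚ.≤ g i) → sumᶠ f ℚ.≤ sumᶠ g
  sumᶠ-mono {zero}  h = ℚ.≤-refl
  sumᶠ-mono {suc n} h = ℚ.+-mono-≤ (h zero) (sumᶠ-mono (h ∘ suc))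

  sumᶠ-const : ∀ n x → sumᶠ {n} (const x) ≡ ℕ→ℚ n ℚ.* x
  sumᶠ-const zero    x = sym (ℚ.*-zeroˡ x)
  sumᶠ-const (suc n) x = trans (cong (x ℚ.+_) (sumᶠ-const n x)) (sym (ℕ→ℚ-suc-* n x))

  sumᶠ-zero : ∀ {n} {f : Fin n → ℚ} → (∀ i → f i ≡ 0ℚ) → sumᶠ f ≡ 0ℚ
  sumᶠ-zero {n} h = trans (sumᶠ-cong h) (trans (sumᶠ-const n 0ℚ) (ℚ.*-zeroʳ (ℕ→ℚ n)))

  sumᶠ-nonneg : ∀ {n} {f : Fin n → ℚ} → (∀ i → 0ℚ ℚ.≤ f i) → 0ℚ ℚ.≤ sumᶠ f
  sumᶠ-nonneg {zero}  h = ℚ.≤-refl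
  sumᶠ-nonneg {suc n} h = ℚ.+-mono-≤ (h zero) (sumᶠ-nonneg (h ∘ suc))

  sumᶠ-++ : ∀ m {n} (f : Fin (m ℕ.+ n) → ℚ) → sumᶠ f ≡ sumᶠ (f ∘ (_↑ˡ n)) ℚ.+ sumᶠ (f ∘ (m ↑ʳ_))
  sumᶠ-++ zero    f = sym (ℚ.+-identityˡ (sumᶠ f))
  sumᶠ-++ (suc m) f = trans (cong (f zero ℚ.+_) (sumᶠ-++ m (f ∘ suc))) (sym (ℚ.+-assoc (f zero) _ _))

  term≤sumᶠ : ∀ {n} {f : Fin n → ℚ} → (∀ i → 0ℚ ℚ.≤ f i) → ∀ i → f i ℚ.≤ sumᶠ f
  term≤sumᶠ {f = f} h zero    = subst (ℚ._≤ sumᶠ f) (ℚ.+-identityʳ (f zero)) (ℚ.+-monoʳ-≤ (f zero) (sumᶠ-nonneg (h ∘ suc)))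
  term≤sumᶠ {f = f} h (suc i) = subst (ℚ._≤ sumᶠ f) (ℚ.+-identityˡ (f (suc i))) (ℚ.+-mono-≤ (h zero) (term≤sumᶠ (h ∘ suc) i))

  if-nonneg : ∀ b {x} → 0ℚ ℚ.≤ x → 0ℚ ℚ.≤ (if b then x else 0ℚ)
  if-nonneg true  0≤x = 0≤x
  if-nonneg false 0≤x = ℚ.≤-refl

  sumᶠ-single : ∀ {k} (b : Fin k → Bool) → (∀ i j → T (b i) → T (b j) → i ≡ j) →
                ∀ {x} → 0ℚ ℚ.≤ x → sumᶠ (λ i → if b i then x else 0ℚ) ℚ.≤ x
  sumᶠ-single {zero}  b one 0≤x = 0≤x
  sumᶠ-single {suc k} b one {x} 0≤x with b zero in eq
  ... | false = subst (ℚ._≤ x) (sym (ℚ.+-identityˡ _))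
                  (sumᶠ-single (b ∘ suc) (λ i j bi bj → Fin.suc-injective (one (suc i) (suc j) bi bj)) 0≤x)
  ... | true  = ℚ.≤-reflexive (trans (cong (x ℚ.+_) (sumᶠ-zero rest)) (ℚ.+-identityʳ x))
    where
    rest : ∀ i → (if b (suc i) then x else 0ℚ) ≡ 0ℚ
    rest i with b (suc i) in eq′
    ... | false = refl
    ... | true with one zero (suc i) (subst T (sym eq) tt) (subst T (sym eq′) tt)
    ...   | ()

  -- After exchanging the sums, each `x v` is counted at most once, because v belongs to at most one
  -- of the sets. This is the packing side of the duality for fractional domination.
  sumᶠ-disjoint : ∀ {k n} (b : Fin k → Fin n → Bool) → (∀ i j v → T (b i v) → T (b j v) → i ≡ j) →
                  (x : Fin n → ℚ) → (∀ v → 0ℚ ℚ.≤ x v) →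
                  sumᶠ (λ i → sumᶠ (λ v → if b i v then x v else 0ℚ)) ℚ.≤ sumᶠ x
  sumᶠ-disjoint b one x 0≤x = subst (ℚ._≤ sumᶠ x) (sym (sumᶠ-comm (λ i v → if b i v then x v else 0ℚ)))
    (sumᶠ-mono (λ v → sumᶠ-single (λ i → b i v) (λ i j → one i j v) (0≤x v)))

  -- The singletons of the values f i are disjoint, so `sumᶠ-disjoint` applies to their indicators.
  sumᶠ-injective : ∀ {k n} {f : Fin k → Fin n} → (∀ {i j} → f i ≡ f j → i ≡ j) →
                   (x : Fin n → ℚ) → (∀ v → 0ℚ ℚ.≤ x v) → sumᶠ (x ∘ f) ℚ.≤ sumᶠ x
  sumᶠ-injective {f = f} f-injective x 0≤x = ℚ.≤-trans
    (sumᶠ-mono (λ i → subst (ℚ._≤ sumᶠ (λ v → if does (f i Fin.≟ v) then x v else 0ℚ)) (diagonal (f i))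
       (term≤sumᶠ (λ v → if-nonneg (does (f i Fin.≟ v)) (0≤x v)) (f i))))
    (sumᶠ-disjoint (λ i v → does (f i Fin.≟ v)) one x 0≤x)
    where
    diagonal : ∀ w → (if does (w Fin.≟ w) then x w else 0ℚ) ≡ x w
    diagonal w with w Fin.≟ w
    ... | yes _  = refl
    ... | no w≢w = ⊥-elim (w≢w refl)
    one : ∀ i j v → T (does (f i Fin.≟ v)) → T (does (f j Fin.≟ v)) → i ≡ j
    one i j v p q with f i Fin.≟ v | f j Fin.≟ v
    ... | yes fi≡v | yes fj≡v = f-injective (trans fi≡v (sym fj≡v))

open RationalSums

-- Reachability, clique minors and domination numbers

module Graphs where

  open import Data.Nat using (_+_; _<_)
  open Equivalence using (to; from)

  anyᶠ⁺ : ∀ {m} {f : Fin m → Bool} i → T (f i) → T (anyᶠ f)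
  anyᶠ⁺ {f = f} zero    t = from (T-∨ {f zero}) (inj₁ t)
  anyᶠ⁺ {f = f} (suc i) t = from (T-∨ {f zero}) (inj₂ (anyᶠ⁺ i t))

  anyᶠ⁻ : ∀ {m} {f : Fin m → Bool} → T (anyᶠ f) → ∃ λ i → T (f i)
  anyᶠ⁻ {suc m} {f} t with to (T-∨ {f zero}) t
  ... | inj₁ t₀ = zero , t₀
  ... | inj₂ t₁ = let i , tᵢ = anyᶠ⁻ t₁ in suc i , tᵢ

  module _ (G : Graph) where

    Adjacent : Fin (n G) → Fin (n G) → Set
    Adjacent u v = T (adj G u v)

    module _ {S : Fin (n G) → Bool} where

      reach⇒walk : ∀ l {u v} → T (reachWithin G S l u v) → Walk Adjacent (T ∘ S) l u v
      reach⇒walk zero {u} t with to (T-∧ {S u}) t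
      ... | Su , u≡v with refl ← toWitness u≡v = stop Su
      reach⇒walk (suc l) {u} {v} t with to (T-∨ {reachWithin G S l u v}) t
      ... | inj₁ t₁ = lengthen (ℕ.n≤1+n l) (reach⇒walk l t₁)
      ... | inj₂ t₂ with anyᶠ⁻ t₂
      ...   | w , tw with to (T-∧ {reachWithin G S l u w}) tw
      ...     | uw , tv with to (T-∧ {adj G w v}) tv
      ...       | wv , Sv = snoc (reach⇒walk l uw) wv Sv

      reach-lengthen : ∀ k {l u v} → T (reachWithin G S l u v) → T (reachWithin G S (k + l) u v)
      reach-lengthen zero t = t
      reach-lengthen (suc k) {l} {u} {v} t = from (T-∨ {reachWithin G S (k + l) u v}) (inj₁ (reach-lengthen k t))

      -- `reachWithin` grows at the far end, a `Walk` at the near end. The part already travelled is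
      -- therefore kept as an accumulator while the walk is consumed.
      reach-walk : ∀ {k l u v w} → T (reachWithin G S k u v) → Walk Adjacent (T ∘ S) l v w → T (reachWithin G S (l + k) u w)
      reach-walk {l = l} t (stop _) = reach-lengthen l t
      reach-walk {k} {suc l} {u} {v} {w} t (go {y = y} _ e p) =
        subst (λ m → T (reachWithin G S m u w)) (ℕ.+-suc l k) (reach-walk step p)
        where
        step : T (reachWithin G S (suc k) u y)
        step = from (T-∨ {reachWithin G S k u y}) (inj₂ (anyᶠ⁺ v (from (T-∧ {reachWithin G S k u v}) (t , from (T-∧ {adj G v y}) (e , source p)))))

      walk⇒reach : ∀ {l u v} → Walk Adjacent (T ∘ S) l u v → T (reachWithin G S l u v)
      walk⇒reach {l} {u} {v} w = subst (λ m → T (reachWithin G S m u v)) (ℕ.+-identityʳ l)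
        (reach-walk {0} (from (T-∧ {S u}) (source w , fromWitness {a? = u Fin.≟ u} refl)) w)

  CliqueDepthMinor-≤ : ∀ {ρ s t G} → s ≤ t → CliqueDepthMinor ρ t G → CliqueDepthMinor ρ s G
  CliqueDepthMinor-≤ s≤t (B , c , c∈B , reach , disjoint , edge) =
    B ∘ ι , c ∘ ι , c∈B ∘ ι , reach ∘ ι
    , (λ i j v i≢j → disjoint (ι i) (ι j) v (i≢j ∘ Fin.inject≤-injective s≤t s≤t i j))
    , (λ i j i≢j → edge (ι i) (ι j) (i≢j ∘ Fin.inject≤-injective s≤t s≤t i j))
    where
    ι = λ i → inject≤ i s≤t

  -- Branch sets are disjoint, so their centres are distinct vertices. This bounds the clique minors
  -- of the finitely many graphs whose separation is too small for the given depth.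
  CliqueDepthMinor-order : ∀ {ρ t G} → CliqueDepthMinor ρ t G → t ≤ n G
  CliqueDepthMinor-order {t = t} (B , c , c∈B , _ , disjoint , _) = Fin.injective⇒≤ c-injective
    where
    c-injective : ∀ {i j} → c i ≡ c j → i ≡ j
    c-injective {i} {j} ci≡cj with i Fin.≟ j
    ... | yes i≡j = i≡j
    ... | no  i≢j = ⊥-elim (disjoint i j (c i) i≢j (c∈B i) (subst (_∈ˢ B j) (sym ci≡cj) (c∈B j)))

  least : ∀ {P : Pred ℕ 0ℓ} → Decidable P → ∀ {k} → P k → ∃ λ m → P m × (∀ j → P j → m ≤ j)
  least {P} P? {k} Pk = search k 0 (ℕ.+-identityʳ k) (λ _ ())
    where
    search : ∀ f m → f + m ≡ k → (∀ j → j < m → ¬ P j) → ∃ λ m → P m × (∀ j → P j → m ≤ j)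
    search f m f+m≡k below with P? m
    ... | yes Pm = m , Pm , λ j Pj → ℕ.≮⇒≥ (λ j<m → below j j<m Pj)
    search zero m refl below | no ¬Pm = contradiction Pk ¬Pm
    search (suc f) m f+m≡k below | no ¬Pm = search f (suc m) (trans (ℕ.+-suc f m) f+m≡k) below′
      where
      below′ : ∀ j → j < suc m → ¬ P j
      below′ j (s≤s j≤m) Pj with ℕ.m≤n⇒m<n∨m≡n j≤m
      ... | inj₁ j<m  = below j j<m Pj
      ... | inj₂ refl = ¬Pm Pj

  -- Domination is decidable and the full vertex set dominates, so a search through the sizes finds
  -- the minimum.
  domNumber : ∀ G r → ∃ λ k → IsDomNumber G r k
  domNumber G r = k , attained , λ D dom → minimal ∣ D ∣ (D , dom , refl)
    where
    dominating? : ∀ D → Dec (IsRDominating G r D)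
    dominating? D = Fin.all? (λ u → Fin.any? (λ v → (v ∈ˢ? D) ×-dec T? (inBall G r u v)))
    everything : IsRDominating G r ⊤
    everything u = u , ∈⊤ , walk⇒reach G {l = r} (stop tt)
    optimum = least (λ k → anySubset? (λ D → dominating? D ×-dec (∣ D ∣ ℕ.≟ k))) (⊤ , everything , refl)
    k = proj₁ optimum
    attained = proj₁ (proj₂ optimum)
    minimal = proj₂ (proj₂ optimum)

  -- Graphs on an encoded vertex type, and the step from K₄ minors to triangles

  module Encoded {V : Set} {N : ℕ} (encode : V → Fin N) (decode : Fin N → V)
                 (decode-encode : ∀ x → decode (encode x) ≡ x) (encode-decode : ∀ i → encode (decode i) ≡ i)
                 {_~_ : V → V → Set} (~-sym : Symmetric _~_) (~-irrefl : ∀ {x} → ¬ x ~ x)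
                 (_~?_ : ∀ x y → Dec (x ~ y)) where

    graph : Graph
    graph = record
      { n      = N
      ; adj    = λ u v → ⌊ decode u ~? decode v ⌋
      ; sym    = λ u v → symmetric (decode u) (decode v)
      ; irrefl = λ v → irreflexive (decode v) }
      where
      symmetric : ∀ x y → ⌊ x ~? y ⌋ ≡ ⌊ y ~? x ⌋
      symmetric x y with x ~? y | y ~? x
      ... | yes _ | yes _ = refl
      ... | yes e | no ¬e = contradiction (~-sym e) ¬e
      ... | no ¬e | yes e = contradiction (~-sym e) ¬e
      ... | no _  | no _  = refl
      irreflexive : ∀ x → ⌊ x ~? x ⌋ ≡ false
      irreflexive x with x ~? x
      ... | yes e = contradiction e ~-irrefl
      ... | no  _ = refl

    encode-injective : ∀ {x y} → encode x ≡ encode y → x ≡ y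
    encode-injective {x} {y} e = trans (sym (decode-encode x)) (trans (cong decode e) (decode-encode y))

    adjacent⇒~ : ∀ {u v} → Adjacent graph u v → decode u ~ decode v
    adjacent⇒~ {u} {v} = toWitness {a? = decode u ~? decode v}

    ~⇒adjacent : ∀ {x y} → x ~ y → Adjacent graph (encode x) (encode y)
    ~⇒adjacent {x} {y} e = fromWitness {a? = decode (encode x) ~? decode (encode y)}
      (subst₂ _~_ (sym (decode-encode x)) (sym (decode-encode y)) e)

    inBall⇒walk : ∀ {r u v} → T (inBall graph r u v) → Walk _~_ U r (decode u) (decode v)
    inBall⇒walk {r} t = mapʷ decode adjacent⇒~ (λ _ → tt) (reach⇒walk graph r t)

    walk⇒inBall : ∀ {r x y} → Walk _~_ U r x y → T (inBall graph r (encode x) (encode y))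
    walk⇒inBall w = walk⇒reach graph (mapʷ encode ~⇒adjacent (λ _ → tt) w)

    module _ (hub : V) where

      -- The code of a vertex also serves as its date of construction, so the choice of `encode`
      -- fixes the order of peeling.
      rank : V → ℕ
      rank = toℕ ∘ encode

      rank-injective : ∀ {x y} → rank x ≡ rank y → x ≡ y
      rank-injective e = encode-injective (Fin.toℕ-injective e)

      open Peeling (λ {x} {y} → ~-sym {x} {y}) rank rank-injective (_≢ hub) public

      -- At most one of four disjoint branch sets contains the hub. In each of the others any two
      -- vertices are joined through the centre by a walk of length at most 2ρ, so three of them and
      -- the edges between them form a `Triangle` without the hub.
      noCliqueMinor : ∀ {L ρ} → let l = ρ + ρ in l + suc ((l + suc l) + suc l) ≤ L → Scattered L → ¬ CliqueDepthMinor ρ 4 graph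
      noCliqueMinor {L} {ρ} l≤L scattered (B , c , c∈B , reach , disjoint , edge) = contradict
        where
        Branch : Fin 4 → Pred V 0ℓ
        Branch i x = encode x ∈ˢ B i
        branch-decode : ∀ {i v} → v ∈ˢ B i → Branch i (decode v)
        branch-decode {i} {v} v∈ = subst (_∈ˢ B i) (sym (encode-decode v)) v∈
        branch-disjoint : ∀ {i j} → i ≢ j → Disjoint (Branch i) (Branch j)
        branch-disjoint {i} {j} i≢j {x} = disjoint i j (encode x) i≢j
        HubFree : Fin 4 → Set
        HubFree i = ¬ Branch i hub
        -- Every code is less than `N`, so `Below N` only asks to avoid the hub.
        Inside : Fin 4 → Pred V 0ℓ
        Inside i x = Below N x × Branch i x
        inBranch : ∀ {i v} → HubFree i → v ∈ˢ B i → Inside i (decode v)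
        inBranch {i} {v} free v∈ = ((λ { refl → free (branch-decode v∈) }) , Fin.toℕ<n _) , branch-decode v∈
        fromCentre : ∀ {i v} → HubFree i → v ∈ˢ B i → Walk _~_ (Inside i) ρ (decode (c i)) (decode v)
        fromCentre {i} {v} free v∈ = mapʷ decode adjacent⇒~ (λ {w} t → inBranch free (member w t)) (reach⇒walk graph ρ (reach i v v∈))
          where
          member : ∀ w → T (Vec.lookup (B i) w) → w ∈ˢ B i
          member w t with Vec.lookup (B i) w in eq
          ... | true = lookup⇒[]= w (B i) eq
        joined : ∀ {i u v} → HubFree i → u ∈ˢ B i → v ∈ˢ B i → Walk _~_ (Inside i) (ρ + ρ) (decode u) (decode v)
        joined free u∈ v∈ = reverseʷ ~-sym (fromCentre free u∈) ++ʷ fromCentre free v∈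
        triangle : ∀ i j k → i ≢ j → j ≢ k → k ≢ i → HubFree i → HubFree j → HubFree k → ⊥
        triangle i j k i≢j j≢k k≢i hi hj hk =
          let u₁ , v₁ , u₁∈ , v₁∈ , e₁ = edge i j i≢j
              u₂ , v₂ , u₂∈ , v₂∈ , e₂ = edge j k j≢k
              u₃ , v₃ , u₃∈ , v₃∈ , e₃ = edge k i k≢i
          in noTriangle scattered l≤L N (λ {x} → branch-disjoint i≢j {x}) (λ {x} → branch-disjoint j≢k {x}) (λ {x} → branch-disjoint k≢i {x}) record
               { walkA = joined hi v₃∈ u₁∈ ; walkB = joined hj v₁∈ u₂∈ ; walkC = joined hk v₂∈ u₃∈
               ; a′~b = adjacent⇒~ {u₁} e₁ ; b′~c = adjacent⇒~ {u₂} e₂ ; c′~a = adjacent⇒~ {u₃} e₃ }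
        others : ∀ i → (∀ j → HubFree (punchIn i j)) → ⊥
        others i free = triangle (punchIn i zero) (punchIn i (suc zero)) (punchIn i (suc (suc zero)))
          (λ e → differ (Fin.punchIn-injective i zero (suc zero) e)) (λ e → differ′ (Fin.punchIn-injective i (suc zero) (suc (suc zero)) e))
          (λ e → differ″ (Fin.punchIn-injective i (suc (suc zero)) zero e)) (free zero) (free (suc zero)) (free (suc (suc zero)))
          where
          differ : zero ≢ Fin.suc {2} zero
          differ ()
          differ′ : Fin.suc {2} zero ≢ suc (suc zero)
          differ′ ()
          differ″ : Fin.suc {2} (suc zero) ≢ zero
          differ″ ()
        contradict : ⊥
        contradict with Fin.any? (λ i → encode hub ∈ˢ? B i)
        ... | yes (i , hub∈) = others i (λ j hub∈′ → branch-disjoint (Fin.punchInᵢ≢i i j) {hub} hub∈′ hub∈)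
        -- Any three branch sets will do here; the first is left out.
        ... | no  none       = others zero (λ j hub∈ → none (_ , hub∈))

open Graphs

-- From hypergraphs to graphs: sparse edge lists and subsets

module Spreads where

  open import Data.Nat using (_+_; _*_; _<_)

  lookup∈drop : ∀ {X : Set} (xs : List X) {i j : Fin (length xs)} → i Fin.< j → lookup xs j ∈ drop (suc (toℕ i)) xs
  lookup∈drop (x ∷ xs) {zero}  {suc j} _         = ∈-lookup j
  lookup∈drop (x ∷ xs) {suc i} {suc j} (s≤s i<j) = lookup∈drop xs i<j

  allPairs-∈ : ∀ {X : Set} {R : X → X → Set} → (∀ {x y} → R x y → R y x) → ∀ {k} {xs : Vec X k} → AllPairsᵛ R xs →
               ∀ {x y} → x ∈ᵛ xs → y ∈ᵛ xs → x ≢ y → R x y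
  allPairs-∈ _     (_ ∷ᵖ _)  (Anyᵛ.here refl) (Anyᵛ.here refl) x≢y = contradiction refl x≢y
  allPairs-∈ _     (rs ∷ᵖ _) (Anyᵛ.here refl) (Anyᵛ.there y∈)  _   = Allᵛ.lookup rs y∈
  allPairs-∈ R-sym (rs ∷ᵖ _) (Anyᵛ.there x∈)  (Anyᵛ.here refl) _   = R-sym (Allᵛ.lookup rs x∈)
  allPairs-∈ R-sym (_ ∷ᵖ ps) (Anyᵛ.there x∈)  (Anyᵛ.there y∈)  x≢y = allPairs-∈ R-sym ps x∈ y∈ x≢y

  near-sym : ∀ {n d L p q} {es : List (Edge n d)} → Near es L p q → Near es L q p
  near-sym = reverseʷ (λ (e , e∈ , p∈ , q∈) → e , e∈ , q∈ , p∈)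

  -- The newest edges come first, so `drop (suc (toℕ i))` leaves exactly the edges present when edge
  -- i was added.
  sparse-far : ∀ {n d L} {es : List (Edge n d)} → Sparse L es → ∀ i {p q} → p ∈ᵛ lookup es i → q ∈ᵛ lookup es i → p ≢ q →
               ¬ Near (drop (suc (toℕ i)) es) L p q
  sparse-far (far ∷ _)    zero    = allPairs-∈ (λ ¬near → ¬near ∘ near-sym) far
  sparse-far (_ ∷ sparse) (suc i) = sparse-far sparse i

  -- A point is near itself by the empty walk, so points that are pairwise not near are distinct.
  sparse-unique : ∀ {n d L} {es : List (Edge n d)} → Sparse L es → ∀ i → Uniqueᵛ.Unique (lookup es i)
  sparse-unique (far ∷ _)    zero    = AllPairsᵛ.map (λ { ¬near refl → ¬near (stop tt) }) far
  sparse-unique (_ ∷ sparse) (suc i) = sparse-unique sparse i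

  opposite-< : ∀ {n} {i j : Fin n} → i Fin.< j → opposite j Fin.< opposite i
  opposite-< {n} {i} {j} i<j = subst₂ _<_ (sym (Fin.opposite-prop j)) (sym (Fin.opposite-prop i)) (ℕ.∸-monoʳ-< (s≤s i<j) (Fin.toℕ<n j))

  members : ∀ {n} → Subset n → List (Fin n)
  members []          = []
  members (true  ∷ D) = zero ∷ map suc (members D)
  members (false ∷ D) = map suc (members D)

  length-members : ∀ {n} (D : Subset n) → length (members D) ≡ ∣ D ∣
  length-members []          = refl
  length-members (true  ∷ D) = cong suc (trans (length-map suc (members D)) (length-members D))
  length-members (false ∷ D) = trans (length-map suc (members D)) (length-members D)

  ∈-members : ∀ {n v} {D : Subset n} → v ∈ˢ D → v ∈ members D
  ∈-members Vec.here = here refl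
  ∈-members {D = true  ∷ D} (Vec.there v∈) = there (∈-map⁺ suc (∈-members v∈))
  ∈-members {D = false ∷ D} (Vec.there v∈) = ∈-map⁺ suc (∈-members v∈)

  -- The graph of a hypergraph and its lack of shallow K₄ minors

  module Spread {L d′ : ℕ} (H : Hypergraph L (suc d′)) (r′ : ℕ) where
    open Hypergraph H

    d r P m N : ℕ
    d = suc d′
    r = suc r′
    P = s * d
    m = length edges
    N = P + (m * r + suc r)

    edge : Fin m → Edge P d
    edge = lookup edges

    -- A tail has r vertices, so its last vertex is at distance r from the points of its edge. The
    -- hub path has r + 1 vertices, so its last vertex is at distance r from the hub, which is
    -- `hub zero`.
    data V : Set where
      point : Fin P → V
      tail  : Fin m → Fin r → V
      hub   : Fin (suc r) → V

    -- Each link runs from the smaller code to the larger one, so the older neighbours of v are the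
    -- f with `Link f v`.
    data Link : V → V → Set where
      foot  : ∀ {p e} → p ∈ᵛ edge e → Link (point p) (tail e zero)
      down  : ∀ {e i j} → toℕ j ≡ suc (toℕ i) → Link (tail e i) (tail e j)
      spoke : ∀ {p} → Link (point p) (hub zero)
      axle  : ∀ {i j} → toℕ j ≡ suc (toℕ i) → Link (hub i) (hub j)

    _~_ : V → V → Set
    x ~ y = Link x y ⊎ Link y x

    link? : ∀ x y → Dec (Link x y)
    link? (point p) (point q) = no λ ()
    link? (point p) (tail e zero) with p ∈ᵛ? edge e
    ... | yes p∈ = yes (foot p∈)
    ... | no  p∉ = no λ { (foot p∈) → p∉ p∈ }
    link? (point p) (tail e (suc j)) = no λ ()
    link? (point p) (hub zero) = yes spoke
    link? (point p) (hub (suc j)) = no λ ()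
    link? (tail e i) (point q) = no λ ()
    link? (tail e i) (tail e′ j) with e Fin.≟ e′ | toℕ j ℕ.≟ suc (toℕ i)
    ... | yes refl | yes eq = yes (down eq)
    ... | yes refl | no neq = no λ { (down eq) → neq eq }
    ... | no  e≢e′ | _      = no λ { (down _) → e≢e′ refl }
    link? (tail e i) (hub j) = no λ ()
    link? (hub i) (point q) = no λ ()
    link? (hub i) (tail e j) = no λ ()
    link? (hub i) (hub j) with toℕ j ℕ.≟ suc (toℕ i)
    ... | yes eq = yes (axle eq)
    ... | no neq = no λ { (axle eq) → neq eq }

    ¬Link-self : ∀ {x} → ¬ Link x x
    ¬Link-self (down eq) = ℕ.1+n≢n (sym eq)
    ¬Link-self (axle eq) = ℕ.1+n≢n (sym eq)

    -- Older edges, which come later in the list, get smaller codes.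
    encode : V → Fin N
    encode (point p)  = p ↑ˡ (m * r + suc r)
    encode (tail e j) = P ↑ʳ (combine (opposite e) j ↑ˡ suc r)
    encode (hub j)    = P ↑ʳ (m * r ↑ʳ j)

    decodeTail : Fin m × Fin r → V
    decodeTail (e , j) = tail (opposite e) j

    decode′ : Fin (m * r) ⊎ Fin (suc r) → V
    decode′ = [ decodeTail ∘ remQuot r , hub ]′

    decode : Fin N → V
    decode = [ point , decode′ ∘ splitAt (m * r) ]′ ∘ splitAt P

    decode-encode : ∀ x → decode (encode x) ≡ x
    decode-encode (point p) rewrite Fin.splitAt-↑ˡ P p (m * r + suc r) = refl
    decode-encode (tail e j)
      rewrite Fin.splitAt-↑ʳ P (m * r + suc r) (combine (opposite e) j ↑ˡ suc r)
            | Fin.splitAt-↑ˡ (m * r) (combine (opposite e) j) (suc r)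
            = trans (cong decodeTail (Fin.remQuot-combine (opposite e) j)) (cong (λ e → tail e j) (Fin.opposite-involutive e))
    decode-encode (hub j)
      rewrite Fin.splitAt-↑ʳ P (m * r + suc r) (m * r ↑ʳ j)
            | Fin.splitAt-↑ʳ (m * r) (suc r) j = refl

    encode-decode : ∀ i → encode (decode i) ≡ i
    encode-decode i with splitAt P i in eq
    ... | inj₁ p = Fin.splitAt⁻¹-↑ˡ eq
    ... | inj₂ t = trans (encode-decode′ t) (Fin.splitAt⁻¹-↑ʳ eq)
      where
      encode-decode′ : ∀ t → encode (decode′ (splitAt (m * r) t)) ≡ P ↑ʳ t
      encode-decode′ t with splitAt (m * r) t in eq′
      ... | inj₁ c = cong (P ↑ʳ_) (trans (cong (_↑ˡ suc r) recombine) (Fin.splitAt⁻¹-↑ˡ eq′))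
        where
        recombine : combine (opposite (opposite (proj₁ (remQuot {m} r c)))) (proj₂ (remQuot {m} r c)) ≡ c
        recombine = trans (cong (λ e → combine e (proj₂ (remQuot {m} r c))) (Fin.opposite-involutive (proj₁ (remQuot {m} r c)))) (Fin.combine-remQuot {m} r c)
      ... | inj₂ j = cong (P ↑ʳ_) (Fin.splitAt⁻¹-↑ʳ eq′)

    open Encoded encode decode decode-encode encode-decode {_~_} swap [ ¬Link-self , ¬Link-self ]′
                 (λ x y → link? x y ⊎-dec link? y x) public

    private
      z : V
      z = hub zero

    rank-point : ∀ p → rank z (point p) < P
    rank-point p = subst (_< P) (sym (Fin.toℕ-↑ˡ p _)) (Fin.toℕ<n p)

    rank-tail : ∀ e j → rank z (tail e j) ≡ P + toℕ (combine (opposite e) j)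
    rank-tail e j = trans (Fin.toℕ-↑ʳ P _) (cong (P +_) (Fin.toℕ-↑ˡ (combine (opposite e) j) (suc r)))

    rank-hub : ∀ j → rank z (hub j) ≡ P + (m * r + toℕ j)
    rank-hub j = trans (Fin.toℕ-↑ʳ P _) (cong (P +_) (Fin.toℕ-↑ʳ (m * r) j))

    tail≮point : ∀ {e j p} → ¬ rank z (tail e j) < rank z (point p)
    tail≮point {e} {j} {p} h = ℕ.<-asym (ℕ.≤-<-trans (ℕ.m≤m+n P _) (subst (_< rank z (point p)) (rank-tail e j) h)) (rank-point p)

    hub≮tail : ∀ {i e j} → ¬ rank z (hub i) < rank z (tail e j)
    hub≮tail {i} {e} {j} h = ℕ.<-asym
      (ℕ.+-cancelˡ-< P _ _ (subst₂ _<_ (rank-hub i) (rank-tail e j) h))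
      (ℕ.<-≤-trans (Fin.toℕ<n (combine (opposite e) j)) (ℕ.m≤m+n (m * r) (toℕ i)))

    hub-< : ∀ {i j} → rank z (hub i) < rank z (hub j) → toℕ i < toℕ j
    hub-< {i} {j} h = ℕ.+-cancelˡ-< (m * r) _ _ (ℕ.+-cancelˡ-< P _ _ (subst₂ _<_ (rank-hub i) (rank-hub j) h))

    tail-combine-< : ∀ {e i e′ j} → rank z (tail e i) < rank z (tail e′ j) → combine (opposite e) i Fin.< combine (opposite e′) j
    tail-combine-< {e} {i} {e′} {j} h = ℕ.+-cancelˡ-< P _ _ (subst₂ _<_ (rank-tail e i) (rank-tail e′ j) h)

    tail-< : ∀ {e i j} → rank z (tail e i) < rank z (tail e j) → toℕ i < toℕ j
    tail-< {e} {i} {j} h = ℕ.+-cancelˡ-< (r * toℕ (opposite e)) _ _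
      (subst₂ _<_ (Fin.toℕ-combine (opposite e) i) (Fin.toℕ-combine (opposite e) j) (tail-combine-< {e} {i} {e} {j} h))

    -- `tail e zero` has the smallest code on its path, and the paths are coded from the end of the
    -- edge list forwards. A tail vertex with a smaller code thus belongs to an edge further down
    -- the list.
    older : ∀ {e i e′} → rank z (tail e′ i) < rank z (tail e zero) → e Fin.< e′
    older {e} {i} {e′} h with Fin.<-cmp e e′
    ... | tri< e<e′ _ _ = e<e′
    ... | tri≈ _ refl _ = contradiction (tail-< {e} {i} {zero} h) ℕ.n≮0
    ... | tri> _ _ e′<e = contradiction (Fin.combine-monoˡ-< zero i (opposite-< e′<e)) (ℕ.<-asym (tail-combine-< {e′} {i} {e} {zero} h))

    module _ (e : Fin m) where

      -- A vertex on the tail of e′ is represented by some point of edge e′, so that a walk in the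
      -- graph projects to hops in the hypergraph.
      Trace : ℕ → V → Fin P → Set
      Trace l (point p)   q = Near (drop (suc (toℕ e)) edges) l p q
      Trace l (tail e′ j) q = ∃ λ p → p ∈ᵛ edge e′ × Near (drop (suc (toℕ e)) edges) l p q
      Trace l (hub j)     q = ⊥

      -- Only entering a tail from a point costs a hop, along an edge that predates e by `older`.
      -- Hub vertices do not occur below `tail e zero`.
      trace : ∀ {l x q} → Walk _~_ (Below z (rank z (tail e zero))) l x (point q) → Trace l x q
      trace (stop _) = stop tt
      trace (go _ (inj₁ (foot p∈)) w) with trace w
      ... | p′ , p′∈ , near = go tt (_ , lookup∈drop edges (older (proj₂ (source w))) , p∈ , p′∈) near
      trace (go _ (inj₁ (down _)) w) with trace w
      ... | p , p∈ , near = p , p∈ , lengthen (ℕ.n≤1+n _) near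
      trace (go _ (inj₁ spoke) w) = ⊥-elim (proj₁ (source w) refl)
      trace (go {x = hub i} (_ , below) (inj₁ (axle _)) w) = hub≮tail {i} {e} {zero} below
      trace (go _ (inj₂ (foot p∈)) w) = _ , p∈ , lengthen (ℕ.n≤1+n _) (trace w)
      trace (go _ (inj₂ (down _)) w) with trace w
      ... | p , p∈ , near = p , p∈ , lengthen (ℕ.n≤1+n _) near
      trace (go {x = hub i} (_ , below) (inj₂ spoke) w) = hub≮tail {i} {e} {zero} below
      trace (go {x = hub i} (_ , below) (inj₂ (axle _)) w) = hub≮tail {i} {e} {zero} below

    -- Apart from the hub, only `tail e zero` can have several older neighbours, namely the points
    -- of edge e. A walk between two of these projects by `trace` to one in the older edges, against
    -- `sparse`.
    scattered : Scattered z L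
    scattered {v} {f} {f′} Uv f≢f′ vf vf′ w = cases vf vf′ (proj₁ (source w)) (proj₁ (target w)) (proj₂ (source w)) (proj₂ (target w)) w f≢f′ Uv
      where
      asym : ∀ {a b : ℕ} → a ≡ suc b → ¬ a < b
      asym refl h = ℕ.<-asym h (ℕ.n<1+n _)
      equal : ∀ {k} {i j j′ : Fin k} → toℕ i ≡ suc (toℕ j) → toℕ i ≡ suc (toℕ j′) → j ≡ j′
      equal e e′ = Fin.toℕ-injective (ℕ.suc-injective (trans (sym e) e′))
      cases : ∀ {v f f′} → v ~ f → v ~ f′ → f ≢ z → f′ ≢ z → rank z f < rank z v → rank z f′ < rank z v →
              Walk _~_ (Below z (rank z v)) L f f′ → f ≢ f′ → v ≢ z → ⊥
      cases {point p} (inj₁ (foot {e = e} _)) _ _ _ lt _ _ _ _ = tail≮point {e} {zero} {p} lt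
      cases {point p} (inj₁ spoke) _ f≢z _ _ _ _ _ _ = f≢z refl
      cases {tail e i} (inj₁ (down {j = j} eq)) _ _ _ lt _ _ _ _ = asym eq (tail-< {e} {j} {i} lt)
      cases {tail e i} (inj₂ _) (inj₁ (down {j = j} eq)) _ _ _ lt _ _ _ = asym eq (tail-< {e} {j} {i} lt)
      cases {tail e i} (inj₂ (foot p∈)) (inj₂ (foot q∈)) _ _ _ _ w f≢f′ _ =
        sparse-far sparse e p∈ q∈ (λ { refl → f≢f′ refl }) (trace e w)
      cases {tail e i} (inj₂ (foot p∈)) (inj₂ (down ())) _ _ _ _ _ _ _
      cases {tail e i} (inj₂ (down ())) (inj₂ (foot q∈)) _ _ _ _ _ _ _
      cases {tail e i} (inj₂ (down eq)) (inj₂ (down eq′)) _ _ _ _ _ f≢f′ _ = f≢f′ (cong (tail e) (equal eq eq′))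
      cases {hub i} (inj₁ (axle {j = j} eq)) _ _ _ lt _ _ _ _ = asym eq (hub-< {j} {i} lt)
      cases {hub i} (inj₂ spoke) _ _ _ _ _ _ _ v≢z = v≢z refl
      cases {hub i} (inj₂ (axle _)) (inj₁ (axle {j = j} eq)) _ _ _ lt _ _ _ = asym eq (hub-< {j} {i} lt)
      cases {hub i} (inj₂ (axle _)) (inj₂ spoke) _ _ _ _ _ _ v≢z = v≢z refl
      cases {hub i} (inj₂ (axle eq)) (inj₂ (axle eq′)) _ _ _ _ _ f≢f′ _ = f≢f′ (cong hub (equal eq eq′))

    noK₄Minor : ∀ {ρ} → let l = ρ + ρ in l + suc ((l + suc l) + suc l) ≤ L → ¬ CliqueDepthMinor ρ 4 graph
    noK₄Minor {ρ} l≤L = noCliqueMinor z {ρ = ρ} l≤L (λ {v} {f} {f′} → scattered {v} {f} {f′})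

  -- The two domination numbers of the graph

  module Ratio {L d′ : ℕ} (H : Hypergraph L (suc d′)) (r′ : ℕ) where
    open Hypergraph H
    open Spread H r′

    end : Fin m → V
    end e = tail e (fromℕ r′)

    hubEnd : V
    hubEnd = hub (fromℕ r)

    alongTail : ∀ k e {j p} → toℕ j ≡ k → p ∈ᵛ edge e → Walk _~_ U (suc k) (tail e j) (point p)
    alongTail zero    e {zero}  refl p∈ = go tt (inj₂ (foot p∈)) (stop tt)
    alongTail (suc k) e {suc j} eq   p∈ = go tt (inj₂ (down (cong suc (sym (Fin.toℕ-inject₁ j)))))
      (alongTail k e (trans (Fin.toℕ-inject₁ j) (ℕ.suc-injective eq)) p∈)

    alongHub : ∀ k {j} → toℕ j ≡ k → Walk _~_ U k (hub j) (hub zero)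
    alongHub zero    {zero}  refl = stop tt
    alongHub (suc k) {suc j} eq   = go tt (inj₂ (axle (cong suc (sym (Fin.toℕ-inject₁ j)))))
      (alongHub k (trans (Fin.toℕ-inject₁ j) (ℕ.suc-injective eq)))

    head∈ : ∀ e → head (edge e) ∈ᵛ edge e
    head∈ e with edge e
    ... | _ ∷ _ = Anyᵛ.here refl

    -- Through a point of its edge, `tail e j` reaches the hub in j + 2 steps. This is at most r =
    -- r′ + 1 unless j = r′, that is, unless the vertex is an end.
    end-or-near-hub : ∀ x → (∃ λ e → x ≡ end e) ⊎ Walk _~_ U r x (hub zero)
    end-or-near-hub (point p) = inj₂ (go tt (inj₁ spoke) (stop tt))
    end-or-near-hub (hub j)   = inj₂ (lengthen (ℕ.≤-pred (Fin.toℕ<n j)) (alongHub (toℕ j) refl))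
    end-or-near-hub (tail e j) with toℕ j ℕ.≟ r′
    ... | yes j≡r′ = inj₁ (e , cong (tail e) (Fin.toℕ-injective (trans j≡r′ (sym (Fin.toℕ-fromℕ r′)))))
    ... | no  j≢r′ = inj₂ (lengthen (s≤s (ℕ.≤∧≢⇒< (ℕ.≤-pred (Fin.toℕ<n j)) j≢r′))
                            (snoc (alongTail (toℕ j) e refl (head∈ e)) (inj₁ spoke) tt))

    Around : Fin m → V → Set
    Around e (point p)   = p ∈ᵛ edge e
    Around e (tail e′ j) = e ≡ e′
    Around e (hub j)     = ⊥

    -- Such a walk reaches the points of e with its last permitted step at the earliest, so it
    -- cannot go on from there.
    around-tail : ∀ {l e i y} → l ≤ suc (toℕ i) → Walk _~_ U l (tail e i) y → Around e y
    around-tail _ (stop _) = refl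
    around-tail (s≤s l≤) (go _ (inj₁ (down eq)) w) =
      around-tail (ℕ.≤-trans l≤ (ℕ.≤-trans (ℕ.n≤1+n _) (ℕ.≤-trans (ℕ.≤-reflexive (sym eq)) (ℕ.n≤1+n _)))) w
    around-tail (s≤s l≤) (go _ (inj₂ (down eq)) w) = around-tail (ℕ.≤-trans l≤ (ℕ.≤-reflexive eq)) w
    around-tail (s≤s z≤n) (go _ (inj₂ (foot p∈)) (stop _)) = p∈

    around-end : ∀ {e y} → Walk _~_ U r (end e) y → Around e y
    around-end = around-tail (s≤s (ℕ.≤-reflexive (sym (Fin.toℕ-fromℕ r′))))

    -- With at most i steps from `hub i` the walk arrives at `hub zero` in its last step at the
    -- earliest, so it never leaves the path.
    near-hub : ∀ {l i y} → l ≤ toℕ i → Walk _~_ U l (hub i) y → ∃ λ j → y ≡ hub j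
    near-hub _ (stop _) = _ , refl
    near-hub l≤ (go _ (inj₁ (axle eq)) w) = near-hub (ℕ.≤-trans (ℕ.≤-trans (ℕ.n≤1+n _) l≤) (ℕ.≤-trans (ℕ.n≤1+n _) (ℕ.≤-reflexive (sym eq)))) w
    near-hub l≤ (go _ (inj₂ (axle eq)) w) = near-hub (ℕ.≤-pred (ℕ.≤-trans l≤ (ℕ.≤-reflexive eq))) w
    near-hub () (go _ (inj₂ spoke) w)

    -- Turns a dominating set into a set of points. The value at `hub j` is a default, as hub
    -- vertices lie around no end.
    nearestPoint : V → Fin P
    nearestPoint (point p)  = p
    nearestPoint (tail e j) = head (edge e)
    nearestPoint (hub j)    = combine (Fin.fromℕ< 0<s) zero

    nearestPoint∈ : ∀ {e} x → Around e x → nearestPoint x ∈ᵛ edge e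
    nearestPoint∈     (point p)  p∈   = p∈
    nearestPoint∈ {e} (tail e j) refl = head∈ e

    -- The vertex that dominates an end lies on the tail or among the points of that edge, so its
    -- `nearestPoint` belongs to the edge. The images of D thus meet every edge, whereas `evade`
    -- gives an edge avoiding any list of at most P/2 points.
    dominating-large : ∀ D → IsRDominating graph r D → P < 2 * ∣ D ∣
    dominating-large D dom = ℕ.≰⇒> λ small →
      let e , e∈ , e∉X = evade X (subst (λ k → 2 * k ≤ P) (sym (trans (length-map _ (members D)) (length-members D))) small)
          i = index e∈
          v , v∈D , near = dom (encode (end i))
          around = around-end (subst (λ x → Walk _~_ U r x (decode v)) (decode-encode (end i)) (inBall⇒walk {r} near))
      in Allᵛ.lookup (subst (Allᵛ (_∉ X)) (lookup-index e∈) e∉X) (nearestPoint∈ (decode v) around)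
           (∈-map⁺ (nearestPoint ∘ decode) (∈-members v∈D))
      where
      X : List (Fin P)
      X = map (nearestPoint ∘ decode) (members D)

    share : ℚ
    share = (ℚ.1/ ℕ→ℚ d) {{ℚ.pos⇒nonZero (ℕ→ℚ d) {{ℚ.positive (ℕ→ℚ-mono-< {0} {d} (s≤s z≤n))}}}}

    d*share : ℕ→ℚ d ℚ.* share ≡ 1ℚ
    d*share = ℚ.*-inverseʳ (ℕ→ℚ d) {{ℚ.pos⇒nonZero (ℕ→ℚ d) {{ℚ.positive (ℕ→ℚ-mono-< {0} {d} (s≤s z≤n))}}}}

    0≤share : 0ℚ ℚ.≤ share
    0≤share = ℚ.<⇒≤ (ℚ.*-cancelˡ-<-nonNeg (ℕ→ℚ d) {{ℚ.nonNegative (0≤ℕ→ℚ d)}}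
      (subst₂ ℚ._<_ (sym (ℚ.*-zeroʳ (ℕ→ℚ d))) (sym d*share) 0<1))

    weight : V → ℚ
    weight (point p)     = share
    weight (tail e j)    = 0ℚ
    weight (hub zero)    = 1ℚ
    weight (hub (suc j)) = 0ℚ

    0≤weight : ∀ x → 0ℚ ℚ.≤ weight x
    0≤weight (point p)     = 0≤share
    0≤weight (tail e j)    = ℚ.≤-refl
    0≤weight (hub zero)    = 0≤1
    0≤weight (hub (suc j)) = ℚ.≤-refl

    total : sumᶠ (weight ∘ decode) ≡ ℕ→ℚ (suc s)
    total = begin
      sumᶠ (weight ∘ decode)
        ≡⟨ sumᶠ-++ P (weight ∘ decode) ⟩
      sumᶠ (weight ∘ decode ∘ encode ∘ point) ℚ.+ sumᶠ (weight ∘ decode ∘ (P ↑ʳ_))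
        ≡⟨ cong₂ ℚ._+_ points (sumᶠ-++ (m * r) (weight ∘ decode ∘ (P ↑ʳ_))) ⟩
      ℕ→ℚ s ℚ.+ (sumᶠ (weight ∘ decode ∘ (P ↑ʳ_) ∘ (_↑ˡ suc r)) ℚ.+ sumᶠ (weight ∘ decode ∘ (P ↑ʳ_) ∘ (m * r ↑ʳ_)))
        ≡⟨ cong (ℕ→ℚ s ℚ.+_) (cong₂ ℚ._+_ (sumᶠ-zero tails) hubs) ⟩
      ℕ→ℚ s ℚ.+ (0ℚ ℚ.+ 1ℚ)
        ≡⟨ ℚ.+-comm (ℕ→ℚ s) 1ℚ ⟩
      1ℚ ℚ.+ ℕ→ℚ s
        ≡⟨ ℕ→ℚ-suc s ⟨
      ℕ→ℚ (suc s) ∎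
      where
      open ≡-Reasoning
      points : sumᶠ (weight ∘ decode ∘ encode ∘ point) ≡ ℕ→ℚ s
      points = begin
        sumᶠ (weight ∘ decode ∘ encode ∘ point)   ≡⟨ sumᶠ-cong (λ p → cong weight (decode-encode (point p))) ⟩
        sumᶠ (const {B = Fin P} share)                  ≡⟨ sumᶠ-const P share ⟩
        ℕ→ℚ (s * d) ℚ.* share                          ≡⟨ cong (ℚ._* share) (ℕ→ℚ-* s d) ⟩
        ℕ→ℚ s ℚ.* ℕ→ℚ d ℚ.* share                      ≡⟨ ℚ.*-assoc (ℕ→ℚ s) (ℕ→ℚ d) share ⟩
        ℕ→ℚ s ℚ.* (ℕ→ℚ d ℚ.* share)                    ≡⟨ cong (ℕ→ℚ s ℚ.*_) d*share ⟩
        ℕ→ℚ s ℚ.* 1ℚ                                   ≡⟨ ℚ.*-identityʳ (ℕ→ℚ s) ⟩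
        ℕ→ℚ s                                          ∎
      tails : ∀ i → weight (decode (P ↑ʳ (i ↑ˡ suc r))) ≡ 0ℚ
      tails i rewrite Fin.splitAt-↑ʳ P (m * r + suc r) (i ↑ˡ suc r) | Fin.splitAt-↑ˡ (m * r) i (suc r) = refl
      hubs : sumᶠ (weight ∘ decode ∘ (P ↑ʳ_) ∘ (m * r ↑ʳ_)) ≡ 1ℚ
      hubs = trans (sumᶠ-cong {g = weight ∘ hub} (λ j → cong weight (decode-encode (hub j))))
        (trans (cong (1ℚ ℚ.+_) (sumᶠ-zero {f = λ j → weight (hub (suc j))} (λ _ → refl))) (ℚ.+-identityʳ 1ℚ))

    -- An end collects 1/d from each of the d points of its edge, which are distinct by sparsity;
    -- every other vertex collects 1 from the hub.
    fractional : IsFracRDominating graph r (weight ∘ decode)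
    fractional = 0≤weight ∘ decode , covered
      where
      within : Fin N → Fin N → ℚ
      within u v = if inBall graph r u v then weight (decode v) else 0ℚ
      0≤within : ∀ u v → 0ℚ ℚ.≤ within u v
      0≤within u v = if-nonneg (inBall graph r u v) (0≤weight (decode v))
      within-near : ∀ {x y} → Walk _~_ U r x y → within (encode x) (encode y) ≡ weight y
      within-near {x} {y} w with inBall graph r (encode x) (encode y) | walk⇒inBall {r} w
      ... | true | _ = cong weight (decode-encode y)
      covered′ : ∀ x → 1ℚ ℚ.≤ sumᶠ (within (encode x))
      covered′ x with end-or-near-hub x
      ... | inj₂ w = subst (ℚ._≤ sumᶠ (within (encode x))) (within-near w) (term≤sumᶠ (0≤within (encode x)) (encode (hub zero)))
      ... | inj₁ (e , refl) = subst (ℚ._≤ sumᶠ (within (encode (end e)))) spread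
              (sumᶠ-injective {f = foot′} foot-injective (within (encode (end e))) (0≤within (encode (end e))))
        where
        foot′ : Fin d → Fin N
        foot′ a = encode (point (Vec.lookup (edge e) a))
        foot-injective : ∀ {a b} → foot′ a ≡ foot′ b → a ≡ b
        foot-injective {a} {b} eq with encode-injective eq
        ... | same = Uniqueᵛ.lookup-injective (sparse-unique sparse e) a b (point-injective same)
          where
          point-injective : ∀ {p q} → point p ≡ point q → p ≡ q
          point-injective refl = refl
        spread : sumᶠ (within (encode (end e)) ∘ foot′) ≡ 1ℚ
        spread = trans (sumᶠ-cong (λ a → within-near (subst (λ k → Walk _~_ U (suc k) (end e) (point (Vec.lookup (edge e) a)))
                   (Fin.toℕ-fromℕ r′) (alongTail (toℕ (fromℕ r′)) e refl (∈ᵛ-lookup a (edge e))))))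
                 (trans (sumᶠ-const d share) d*share)
      covered : ∀ u → 1ℚ ℚ.≤ sumᶠ (within u)
      covered u = subst (λ u → 1ℚ ℚ.≤ sumᶠ (within u)) (encode-decode u) (covered′ (decode u))

    -- The optimal dual solution: the balls of radius r around these vertices are pairwise disjoint.
    centre : Fin (suc s) → V
    centre zero    = hubEnd
    centre (suc k) = end (index (row∈ k))

    -- The ball around an end stays on its tail and the points of its edge, and rows are disjoint;
    -- the ball around `hubEnd` stays on the hub path.
    centre-disjoint : ∀ i j {y} → Walk _~_ U r (centre i) y → Walk _~_ U r (centre j) y → i ≡ j
    centre-disjoint zero    zero    _ _  = refl
    centre-disjoint zero    (suc k) w w′ with near-hub (ℕ.≤-reflexive (sym (Fin.toℕ-fromℕ r))) w | around-end w′
    ... | _ , refl | ()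
    centre-disjoint (suc k) zero    w w′ with near-hub (ℕ.≤-reflexive (sym (Fin.toℕ-fromℕ r))) w′ | around-end w
    ... | _ , refl | ()
    centre-disjoint (suc k) (suc k′) {y} w w′ = cong suc (same y (around-end w) (around-end w′))
      where
      same : ∀ y → Around (index (row∈ k)) y → Around (index (row∈ k′)) y → k ≡ k′
      same (point p)  p∈ p∈′ = row-disjoint {d = d} (subst (p ∈ᵛ_) (sym (lookup-index (row∈ k))) p∈)
                                                    (subst (p ∈ᵛ_) (sym (lookup-index (row∈ k′))) p∈′)
      same (tail e j) eq eq′ = row-injective {d = d′} (trans (lookup-index (row∈ k))
        (trans (cong edge (trans eq (sym eq′))) (sym (lookup-index (row∈ k′)))))

    -- Weak duality: each of the s + 1 disjoint balls carries weight at least 1.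
    fractional-large : ∀ x → IsFracRDominating graph r x → ℕ→ℚ (suc s) ℚ.≤ sumᶠ x
    fractional-large x (0≤x , covered) = begin
      ℕ→ℚ (suc s)                              ≡⟨ ℚ.*-identityʳ (ℕ→ℚ (suc s)) ⟨
      ℕ→ℚ (suc s) ℚ.* 1ℚ                       ≡⟨ sumᶠ-const (suc s) 1ℚ ⟨
      sumᶠ (const {B = Fin (suc s)} 1ℚ)        ≤⟨ sumᶠ-mono (λ i → covered (encode (centre i))) ⟩
      sumᶠ (λ i → sumᶠ (λ v → if inBall graph r (encode (centre i)) v then x v else 0ℚ))
                                               ≤⟨ sumᶠ-disjoint (λ i v → inBall graph r (encode (centre i)) v) disjoint x 0≤x ⟩
      sumᶠ x                                   ∎
      where
      open ℚ.≤-Reasoning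
      walk : ∀ i v → T (inBall graph r (encode (centre i)) v) → Walk _~_ U r (centre i) (decode v)
      walk i v t = subst (λ y → Walk _~_ U r y (decode v)) (decode-encode (centre i)) (inBall⇒walk {r} t)
      disjoint : ∀ i j v → T (inBall graph r (encode (centre i)) v) → T (inBall graph r (encode (centre j)) v) → i ≡ j
      disjoint i j v t t′ = centre-disjoint i j (walk i v t) (walk j v t′)

    fracDomNumber : IsFracDomNumber graph r (ℕ→ℚ (suc s))
    fracDomNumber = (weight ∘ decode , fractional , total) , fractional-large

-- The nowhere dense class and the unbounded ratio

open Spreads
open import Data.Nat using (_+_)
open import Data.Rational using (_*_; _<_)

-- Far enough apart to exclude depth-m minors of K₄, by noTriangle for walks of length 2m.
separation : ℕ → ℕ
separation m = (m + m) + suc (((m + m) + suc (m + m)) + suc (m + m))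

separation-mono : ∀ {ρ m} → ρ ≤ m → separation ρ ≤ separation m
separation-mono ρ≤m = ℕ.+-mono-≤ 2ρ≤2m (s≤s (ℕ.+-mono-≤ (ℕ.+-mono-≤ 2ρ≤2m (s≤s 2ρ≤2m)) (s≤s 2ρ≤2m)))
  where 2ρ≤2m = ℕ.+-mono-≤ ρ≤m ρ≤m

abstract
  -- With edge size d = 4m + 4 a dominating set has more than sd/2 = 2s(m + 1) elements, against a
  -- fractional optimum of s + 1 ≤ 2s; the ratio thus exceeds m.
  scattering : ∀ m → Hypergraph (separation m) (4 + 4 ℕ.* m)
  scattering m = hypergraph (separation m) (3 + 4 ℕ.* m)

spread : ℕ → ℕ → Graph
spread m r′ = Spread.graph (scattering m) r′

-- A sum stands in for a maximum, since only a common upper bound is wanted.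
sumBelow : ℕ → (ℕ → ℕ) → ℕ
sumBelow zero    f = 0
sumBelow (suc k) f = f k + sumBelow k f

≤sumBelow : ∀ {k i} f → i ℕ.< k → f i ≤ sumBelow k f
≤sumBelow {suc k} f (s≤s i≤k) with ℕ.m≤n⇒m<n∨m≡n i≤k
... | inj₁ i<k  = ℕ.≤-trans (≤sumBelow f i<k) (ℕ.m≤n+m _ (f k))
... | inj₂ refl = ℕ.m≤m+n (f k) _

-- A level m uses one hypergraph for all radii r′ + 1 with r′ ≤ m. So each level is finite, while
-- every positive radius occurs at all sufficiently high levels.
𝒮 : Class
𝒮 G = ∃[ m ] ∃[ r′ ] (r′ ≤ m × G ≡ spread m r′)

-- Graphs of level m ≥ ρ have no K₄ at depth ρ; there are only finitely many others.
𝒮-nowhereDense : NowhereDense 𝒮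
𝒮-nowhereDense ρ = 4 + orders , noMinor
  where
  orders : ℕ
  orders = sumBelow ρ (λ m → sumBelow (suc m) (λ r′ → n (spread m r′)))
  noMinor : ∀ G → 𝒮 G → ¬ CliqueDepthMinor ρ (4 + orders) G
  noMinor _ (m , r′ , r′≤m , refl) minor with ρ ℕ.≤? m
  ... | yes ρ≤m = Spread.noK₄Minor (scattering m) r′ {ρ} (separation-mono ρ≤m)
                    (CliqueDepthMinor-≤ {ρ} {G = spread m r′} (ℕ.m≤m+n 4 orders) minor)
  ... | no  ρ≰m = contradiction (ℕ.≤-trans (CliqueDepthMinor-order {ρ} {G = spread m r′} minor) order≤) (ℕ.<⇒≱ (ℕ.m≤n+m (suc orders) 3))
    where
    order≤ : n (spread m r′) ≤ orders
    order≤ = ℕ.≤-trans (≤sumBelow (λ r′ → n (spread m r′)) (s≤s r′≤m))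
                       (≤sumBelow (λ m → sumBelow (suc m) (λ r′ → n (spread m r′))) (ℕ.≰⇒> ρ≰m))

gap : ∀ {M m s k} → M ≤ m → 0 ℕ.< s → s ℕ.* (4 + 4 ℕ.* m) ℕ.< 2 ℕ.* k → M ℕ.* suc s ℕ.< k
gap {M} {m} {s} {k} M≤m 0<s h = ℕ.*-cancelˡ-< 2 _ _ (ℕ.≤-<-trans bound h)
  where
  open ℕ.≤-Reasoning
  bound : 2 ℕ.* (M ℕ.* suc s) ≤ s ℕ.* (4 + 4 ℕ.* m)
  bound = begin
    -- `0<s` gives s + 1 ≤ 2s.
    2 ℕ.* (M ℕ.* suc s)         ≤⟨ ℕ.*-monoʳ-≤ 2 (ℕ.*-mono-≤ M≤m (ℕ.+-mono-≤ 0<s (ℕ.m≤m+n s 0))) ⟩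
    2 ℕ.* (m ℕ.* (2 ℕ.* s))     ≡⟨ cong (2 ℕ.*_) (ℕ.*-comm m (2 ℕ.* s)) ⟩
    2 ℕ.* (2 ℕ.* s ℕ.* m)       ≡⟨ cong (2 ℕ.*_) (ℕ.*-assoc 2 s m) ⟩
    2 ℕ.* (2 ℕ.* (s ℕ.* m))     ≡⟨ ℕ.*-assoc 2 2 (s ℕ.* m) ⟨
    4 ℕ.* (s ℕ.* m)             ≡⟨ ℕ.*-comm 4 (s ℕ.* m) ⟩
    s ℕ.* m ℕ.* 4               ≡⟨ ℕ.*-assoc s m 4 ⟩
    s ℕ.* (m ℕ.* 4)             ≡⟨ cong (s ℕ.*_) (ℕ.*-comm m 4) ⟩
    s ℕ.* (4 ℕ.* m)             ≤⟨ ℕ.*-monoʳ-≤ s (ℕ.m≤n+m (4 ℕ.* m) 4) ⟩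
    s ℕ.* (4 + 4 ℕ.* m)         ∎

exceeds : ∀ {M m k} → M ≤ m → ∀ r′ → IsDomNumber (spread m r′) (suc r′) k →
          ℕ→ℚ M * ℕ→ℚ (suc (Hypergraph.s (scattering m))) < ℕ→ℚ k
exceeds {M} {m} M≤m r′ ((D , D-dominates , refl) , _) = subst (_< ℕ→ℚ ∣ D ∣) (ℕ→ℚ-* M (suc s))
  (ℕ→ℚ-mono-< {M ℕ.* suc s} {∣ D ∣} (gap {M} {m} {s} {∣ D ∣} M≤m 0<s (Ratio.dominating-large (scattering m) r′ D D-dominates)))
  where open Hypergraph (scattering m)

theorem1p4 : Σ Class λ 𝒞 → NowhereDense 𝒞 ×
    (∀ (r : ℕ) → 1 ≤ r → ∀ (M : ℕ) →
    ∃[ G ] ∃[ k ] ∃[ q ] (𝒞 G × IsDomNumber G r k × IsFracDomNumber G r q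
    × ℕ→ℚ M * q < ℕ→ℚ k))
theorem1p4 = 𝒮 , 𝒮-nowhereDense , unbounded
  where
  unbounded : ∀ (r : ℕ) → 1 ≤ r → ∀ (M : ℕ) →
    ∃[ G ] ∃[ k ] ∃[ q ] (𝒮 G × IsDomNumber G r k × IsFracDomNumber G r q × ℕ→ℚ M * q < ℕ→ℚ k)
  -- Level r′ + M is at least r′, so that the graph belongs to the class, and at least M, so that
  -- the ratio exceeds M.
  unbounded (suc r′) _ M with domNumber (spread (r′ + M) r′) (suc r′)
  ... | k , dom = spread m r′ , k , ℕ→ℚ (suc (Hypergraph.s (scattering m))) , (m , r′ , ℕ.m≤m+n r′ M , refl)
                , dom , Ratio.fracDomNumber (scattering m) r′ , exceeds (ℕ.m≤n+m M r′) r′ dom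
    where m = r′ + M
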